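{- Suppose there is a (polynomial-time) approximation algorithm for Max Cut with approximation ratio $1-\gamma$. Then there exists a (polynomial-time) $(1+\gamma)$-approximation algorithm for SM2 restricted to instances in which every scenario contains at most three jobs.
   Context: An instance of SM2 consists of a finite set $J$ of jobs, a processing time $p_j\ge 0$ for each $j\in J$, and an explicitly listed collection $\mathcal S=\{S_1,\dots,S_k\}$ of scenarios, each scenario $S_i$ being a subset of $J$ (the number $k$ of scenarios is part of the input). For $S\subseteq J$ write $p(S)=\sum_{j\in S}p_j$. A solution is a partition $(A,\bar A)$ of $J$ (jobs in $A$ go to machine 1 and jobs in $\bar A$ go to machine 2; the same assignment is used in all scenarios; a part may be empty). SM2 asks for a partition minimizing the sum of makespans $\sum_{i=1}^k\max\{p(A\cap S_i),p(\bar A\cap S_i)\}$. Max Cut here is the weighted problem: given a graph (parallel edges allowed) with non-negative edge weights, find a partition of the vertices into two sets maximizing the total weight of the edges with endpoints in different sets. For a minimization problem, a $\rho$-approximation ($\rho\ge1$) returns a solution of value at most $\rho$ times the optimum; for a maximization problem, an algorithm with approximation ratio $1-\gamma$ returns a solution of value at least $(1-\gamma)$ times the optimum. -}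

module Defs where

open import Data.Bool.Base using (Bool; true; false; if_then_else_; _xor_)
open import Data.Fin.Base using (Fin; toℕ)
open import Data.Fin.Subset using (Subset; _∩_; ∁; ∣_∣)
open import Data.Integer.Base as ℤ using ()
open import Data.List.Base as List using (List; []; _∷_)
open import Data.List.Relation.Unary.All using (All)
open import Data.Nat.Base as ℕ using (ℕ; suc; _^_)
open import Data.Nat.Logarithm using (⌊log₂_⌋)
open import Data.Product.Base using (Σ; ∃; ∃-syntax; _×_; _,_; proj₁; proj₂)
open import Data.Rational.Unnormalised.Base as ℚᵘ
  using (ℚᵘ; 0ℚᵘ; 1ℚᵘ; _≤_; _<_; _≃_; _⊔_; ↥_; ↧ₙ_)
import Data.Rational.Unnormalised.Properties as ℚᵘ
open import Data.Sum.Base as Sum using (_⊎_; inj₁; inj₂)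
open import Data.Vec.Base as Vec using (Vec; lookup)
open import Function.Bundles using (_⇔_; mk⇔; Equivalence)
open import Relation.Binary.PropositionalEquality.Core using (_≡_; _≢_; refl)
open import Relation.Nullary.Negation.Core using (¬_)

open import Algebra.Properties.CommutativeMonoid.Sum ℚᵘ.+-0-commutativeMonoid
  using (sum)

------------------------------------------------------------------------

-- Two-sided Dedekind cuts, since approximation ratios need not be rational.
-- Roundedness makes both predicates respect _≃_.
record ℝ : Set₁ where
  field
    Lower Upper   : ℚᵘ → Set
    lower-inhab   : ∃ Lower
    upper-inhab   : ∃ Upper
    lower-rounded : ∀ q → Lower q ⇔ (∃[ r ] q < r × Lower r)
    upper-rounded : ∀ q → Upper q ⇔ (∃[ r ] r < q × Upper r)
    disjoint      : ∀ q → ¬ (Lower q × Upper q)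
    located       : ∀ {q r} → q < r → Lower q ⊎ Upper r

open ℝ

NonNegativeℝ : ℝ → Set
NonNegativeℝ ρ = ∀ {q} → Upper ρ q → 0ℚᵘ < q

private
  lower-resp : ∀ ρ {q r} → q ≃ r → Lower ρ q → Lower ρ r
  lower-resp ρ {q} {r} q≃r l with Equivalence.to (lower-rounded ρ q) l
  ... | s , q<s , ls =
    Equivalence.from (lower-rounded ρ r) (s , ℚᵘ.<-respˡ-≃ q≃r q<s , ls)

  upper-resp : ∀ ρ {q r} → q ≃ r → Upper ρ q → Upper ρ r
  upper-resp ρ {q} {r} q≃r u with Equivalence.to (upper-rounded ρ q) u
  ... | s , s<q , us =
    Equivalence.from (upper-rounded ρ r) (s , ℚᵘ.<-respʳ-≃ q≃r s<q , us)

  neg-<ˡ : ∀ {q r} → ℚᵘ.- q < r → ℚᵘ.- r < q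
  neg-<ˡ {q} p = ℚᵘ.<-respʳ-≃ (ℚᵘ.neg-involutive q) (ℚᵘ.neg-mono-< p)

  neg-<ʳ : ∀ {q r} → q < ℚᵘ.- r → r < ℚᵘ.- q
  neg-<ʳ {r = r} p = ℚᵘ.<-respˡ-≃ (ℚᵘ.neg-involutive r) (ℚᵘ.neg-mono-< p)

  cancel : ∀ a q → (a ℚᵘ.+ q) ℚᵘ.- a ≃ q
  cancel a q = begin
    (a ℚᵘ.+ q) ℚᵘ.- a      ≈⟨ ℚᵘ.+-congˡ (ℚᵘ.- a) (ℚᵘ.+-comm a q) ⟩
    (q ℚᵘ.+ a) ℚᵘ.- a      ≈⟨ ℚᵘ.+-assoc q a (ℚᵘ.- a) ⟩
    q ℚᵘ.+ (a ℚᵘ.- a)      ≈⟨ ℚᵘ.+-congʳ q (ℚᵘ.+-inverseʳ a) ⟩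
    q ℚᵘ.+ 0ℚᵘ             ≈⟨ ℚᵘ.+-identityʳ q ⟩
    q                      ∎
    where open ℚᵘ.≃-Reasoning

  uncancel : ∀ a q → a ℚᵘ.+ (q ℚᵘ.- a) ≃ q
  uncancel a q =
    ℚᵘ.≃-trans (ℚᵘ.≃-sym (ℚᵘ.+-assoc a q (ℚᵘ.- a))) (cancel a q)

-ℝ_ : ℝ → ℝ
-ℝ ρ = record
  { Lower         = λ q → Upper ρ (ℚᵘ.- q)
  ; Upper         = λ q → Lower ρ (ℚᵘ.- q)
  ; lower-inhab   = let (q , u) = upper-inhab ρ in
                    ℚᵘ.- q , upper-resp ρ (ℚᵘ.≃-sym (ℚᵘ.neg-involutive q)) u
  ; upper-inhab   = let (q , l) = lower-inhab ρ in
                    ℚᵘ.- q , lower-resp ρ (ℚᵘ.≃-sym (ℚᵘ.neg-involutive q)) l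
  ; lower-rounded = λ q → mk⇔
      (λ u → let (r , r<-q , ur) = Equivalence.to (upper-rounded ρ (ℚᵘ.- q)) u in
        ℚᵘ.- r , neg-<ʳ r<-q , upper-resp ρ (ℚᵘ.≃-sym (ℚᵘ.neg-involutive r)) ur)
      (λ (r , q<r , ur) → Equivalence.from (upper-rounded ρ (ℚᵘ.- q))
        (ℚᵘ.- r , ℚᵘ.neg-mono-< q<r , ur))
  ; upper-rounded = λ q → mk⇔
      (λ l → let (r , -q<r , lr) = Equivalence.to (lower-rounded ρ (ℚᵘ.- q)) l in
        ℚᵘ.- r , neg-<ˡ -q<r , lower-resp ρ (ℚᵘ.≃-sym (ℚᵘ.neg-involutive r)) lr)
      (λ (r , r<q , lr) → Equivalence.from (lower-rounded ρ (ℚᵘ.- q))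
        (ℚᵘ.- r , ℚᵘ.neg-mono-< r<q , lr))
  ; disjoint      = λ q (u , l) → disjoint ρ (ℚᵘ.- q) (l , u)
  ; located       = λ q<r → Sum.swap (located ρ (ℚᵘ.neg-mono-< q<r))
  }

infixr 6 _+ℝ_

_+ℝ_ : ℚᵘ → ℝ → ℝ
a +ℝ ρ = record
  { Lower         = λ q → Lower ρ (q ℚᵘ.- a)
  ; Upper         = λ q → Upper ρ (q ℚᵘ.- a)
  ; lower-inhab   = let (q , l) = lower-inhab ρ in
                    a ℚᵘ.+ q , lower-resp ρ (ℚᵘ.≃-sym (cancel a q)) l
  ; upper-inhab   = let (q , u) = upper-inhab ρ in
                    a ℚᵘ.+ q , upper-resp ρ (ℚᵘ.≃-sym (cancel a q)) u
  ; lower-rounded = λ q → mk⇔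
      (λ l → let (r , q-a<r , lr) = Equivalence.to (lower-rounded ρ (q ℚᵘ.- a)) l in
        a ℚᵘ.+ r
        , ℚᵘ.<-respˡ-≃ (uncancel a q) (ℚᵘ.+-monoʳ-< a q-a<r)
        , lower-resp ρ (ℚᵘ.≃-sym (cancel a r)) lr)
      (λ (r , q<r , lr) → Equivalence.from (lower-rounded ρ (q ℚᵘ.- a))
        (r ℚᵘ.- a , ℚᵘ.+-monoˡ-< (ℚᵘ.- a) q<r , lr))
  ; upper-rounded = λ q → mk⇔
      (λ u → let (r , r<q-a , ur) = Equivalence.to (upper-rounded ρ (q ℚᵘ.- a)) u in
        a ℚᵘ.+ r
        , ℚᵘ.<-respʳ-≃ (uncancel a q) (ℚᵘ.+-monoʳ-< a r<q-a)
        , upper-resp ρ (ℚᵘ.≃-sym (cancel a r)) ur)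
      (λ (r , r<q , ur) → Equivalence.from (upper-rounded ρ (q ℚᵘ.- a))
        (r ℚᵘ.- a , ℚᵘ.+-monoˡ-< (ℚᵘ.- a) r<q , ur))
  ; disjoint      = λ q → disjoint ρ (q ℚᵘ.- a)
  ; located       = λ q<r → located ρ (ℚᵘ.+-monoˡ-< (ℚᵘ.- a) q<r)
  }

-- v ≤ ρ w and ρ w ≤ v for a real ρ and rationals v and w.  These are
-- correct for w ≥ 0, the only case in which they are used: all objective
-- values below are non-negative.

infix 4 _≤_·_ _·_≤_

_≤_·_ : ℚᵘ → ℝ → ℚᵘ → Set
v ≤ ρ · w = ∀ q → Upper ρ q → v ≤ q ℚᵘ.* w

_·_≤_ : ℝ → ℚᵘ → ℚᵘ → Set
ρ · w ≤ v = ∀ q → Lower ρ q → q ℚᵘ.* w ≤ v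

------------------------------------------------------------------------

-- The model of computation is a variable-free while language over numbers,
-- pairs and lists, with logarithmic cost.

infixr 7 _⊗_

data Ty : Set where
  bool nat : Ty
  _⊗_      : Ty → Ty → Ty
  list     : Ty → Ty

⟦_⟧ : Ty → Set
⟦ bool ⟧   = Bool
⟦ nat ⟧    = ℕ
⟦ A ⊗ B ⟧  = ⟦ A ⟧ × ⟦ B ⟧
⟦ list A ⟧ = List ⟦ A ⟧

-- Numbers are measured by their binary length.
size     : (A : Ty) → ⟦ A ⟧ → ℕ
sizeList : (A : Ty) → List ⟦ A ⟧ → ℕ

size bool     _       = 1
size nat      n       = 1 ℕ.+ ⌊log₂ n ⌋
size (A ⊗ B)  (x , y) = 1 ℕ.+ size A x ℕ.+ size B y
size (list A) xs      = sizeList A xs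

sizeList A []       = 1
sizeList A (x ∷ xs) = 1 ℕ.+ size A x ℕ.+ sizeList A xs

private variable
  A B C : Ty

data Op : Ty → Ty → Set where
  id            : Op A A
  lit           : ⟦ B ⟧ → Op A B
  fst           : Op (A ⊗ B) A
  snd           : Op (A ⊗ B) B
  cons          : Op (A ⊗ list A) (list A)
  add monus mul : Op (nat ⊗ nat) nat
  leq           : Op (nat ⊗ nat) bool

⟦_⟧ₒ : Op A B → ⟦ A ⟧ → ⟦ B ⟧
⟦ id ⟧ₒ    x        = x
⟦ lit y ⟧ₒ _        = y
⟦ fst ⟧ₒ   (x , _)  = x
⟦ snd ⟧ₒ   (_ , y)  = y
⟦ cons ⟧ₒ  (x , xs) = x ∷ xs
⟦ add ⟧ₒ   (m , n)  = m ℕ.+ n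
⟦ monus ⟧ₒ (m , n)  = m ℕ.∸ n
⟦ mul ⟧ₒ   (m , n)  = m ℕ.* n
⟦ leq ⟧ₒ   (m , n)  = m ℕ.≤ᵇ n

infixr 5 _⨾_

data Prog : Ty → Ty → Set where
  op       : Op A B → Prog A B
  _⨾_      : Prog A B → Prog B C → Prog A C
  ⟨_,_⟩    : Prog A B → Prog A C → Prog A (B ⊗ C)
  cond     : Prog A bool → Prog A B → Prog A B → Prog A B
  caseList : Prog C B → Prog ((A ⊗ list A) ⊗ C) B → Prog (list A ⊗ C) B
  while    : Prog A bool → Prog A A → Prog A A

-- f ⊢ x ⇓ y ∣ t: on input x, the program f halts with output y at cost t.
-- An operation costs one more than the size of its whole argument, and
-- exceeds that size by at most a constant in its output; hence every value
-- occurring in a run has size linear in the cost of the run, and polynomial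
-- cost is the same as polynomial time on a Turing machine.

infix 3 _⊢_⇓_∣_

data _⊢_⇓_∣_ : Prog A B → ⟦ A ⟧ → ⟦ B ⟧ → ℕ → Set where

  run-op : ∀ {o : Op A B} {x} →
    op o ⊢ x ⇓ ⟦ o ⟧ₒ x ∣ 1 ℕ.+ size A x

  run-⨾ : ∀ {f : Prog A B} {g : Prog B C} {x y z t u} →
    f ⊢ x ⇓ y ∣ t → g ⊢ y ⇓ z ∣ u →
    f ⨾ g ⊢ x ⇓ z ∣ t ℕ.+ u

  run-⟨,⟩ : ∀ {f : Prog A B} {g : Prog A C} {x y z t u} →
    f ⊢ x ⇓ y ∣ t → g ⊢ x ⇓ z ∣ u →
    ⟨ f , g ⟩ ⊢ x ⇓ (y , z) ∣ t ℕ.+ u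

  run-true : ∀ {c} {f g : Prog A B} {x y t u} →
    c ⊢ x ⇓ true ∣ t → f ⊢ x ⇓ y ∣ u →
    cond c f g ⊢ x ⇓ y ∣ t ℕ.+ u

  run-false : ∀ {c} {f g : Prog A B} {x y t u} →
    c ⊢ x ⇓ false ∣ t → g ⊢ x ⇓ y ∣ u →
    cond c f g ⊢ x ⇓ y ∣ t ℕ.+ u

  run-[] : ∀ {f : Prog C B} {g : Prog ((A ⊗ list A) ⊗ C) B} {z y t} →
    f ⊢ z ⇓ y ∣ t →
    caseList f g ⊢ ([] , z) ⇓ y ∣ 1 ℕ.+ size (list A ⊗ C) ([] , z) ℕ.+ t

  run-∷ : ∀ {f : Prog C B} {g : Prog ((A ⊗ list A) ⊗ C) B} {x xs z y t} →
    g ⊢ ((x , xs) , z) ⇓ y ∣ t →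
    caseList f g ⊢ (x ∷ xs , z) ⇓ y
      ∣ 1 ℕ.+ size (list A ⊗ C) (x ∷ xs , z) ℕ.+ t

  run-stop : ∀ {c} {f : Prog A A} {x t} →
    c ⊢ x ⇓ false ∣ t →
    while c f ⊢ x ⇓ x ∣ t

  run-step : ∀ {c} {f : Prog A A} {x y z t u v} →
    c ⊢ x ⇓ true ∣ t → f ⊢ x ⇓ y ∣ u → while c f ⊢ y ⇓ z ∣ v →
    while c f ⊢ x ⇓ z ∣ t ℕ.+ u ℕ.+ v

-- So "there is a run" below means "the run".
⇓-deterministic : ∀ {f : Prog A B} {x y y′ t t′} →
  f ⊢ x ⇓ y ∣ t → f ⊢ x ⇓ y′ ∣ t′ → y ≡ y′ × t ≡ t′
⇓-deterministic run-op run-op = refl , refl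
⇓-deterministic (run-⨾ d e) (run-⨾ d′ e′)
  with refl , refl ← ⇓-deterministic d d′
  with refl , refl ← ⇓-deterministic e e′ = refl , refl
⇓-deterministic (run-⟨,⟩ d e) (run-⟨,⟩ d′ e′)
  with refl , refl ← ⇓-deterministic d d′
  with refl , refl ← ⇓-deterministic e e′ = refl , refl
⇓-deterministic (run-true d e) (run-true d′ e′)
  with refl , refl ← ⇓-deterministic d d′
  with refl , refl ← ⇓-deterministic e e′ = refl , refl
⇓-deterministic (run-true d e) (run-false d′ e′)
  with () , _ ← ⇓-deterministic d d′
⇓-deterministic (run-false d e) (run-true d′ e′)
  with () , _ ← ⇓-deterministic d d′
⇓-deterministic (run-false d e) (run-false d′ e′)
  with refl , refl ← ⇓-deterministic d d′
  with refl , refl ← ⇓-deterministic e e′ = refl , refl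
⇓-deterministic (run-[] d) (run-[] d′)
  with refl , refl ← ⇓-deterministic d d′ = refl , refl
⇓-deterministic (run-∷ d) (run-∷ d′)
  with refl , refl ← ⇓-deterministic d d′ = refl , refl
⇓-deterministic (run-stop d) (run-stop d′)
  with refl , refl ← ⇓-deterministic d d′ = refl , refl
⇓-deterministic (run-stop d) (run-step d′ _ _)
  with () , _ ← ⇓-deterministic d d′
⇓-deterministic (run-step d _ _) (run-stop d′)
  with () , _ ← ⇓-deterministic d d′
⇓-deterministic (run-step d e k) (run-step d′ e′ k′)
  with refl , refl ← ⇓-deterministic d d′
  with refl , refl ← ⇓-deterministic e e′
  with refl , refl ← ⇓-deterministic k k′ = refl , refl

------------------------------------------------------------------------

record OptProblem : Set₁ where
  field
    Instance       : Set
    Solution       : Instance → Set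
    value          : (I : Instance) → Solution I → ℚᵘ
    inTy outTy     : Ty
    encode         : Instance → ⟦ inTy ⟧
    encodeSolution : {I : Instance} → Solution I → ⟦ outTy ⟧

restrict : (P : OptProblem) → (OptProblem.Instance P → Set) → OptProblem
restrict P Q = record
  { Instance       = Σ Instance Q
  ; Solution       = λ I → Solution (proj₁ I)
  ; value          = λ I → value (proj₁ I)
  ; inTy           = inTy
  ; outTy          = outTy
  ; encode         = λ I → encode (proj₁ I)
  ; encodeSolution = encodeSolution
  }
  where open OptProblem P

module _ (P : OptProblem) where
  open OptProblem P

  IsMinimal IsMaximal : {I : Instance} → Solution I → Set
  IsMinimal {I} s* = ∀ s → value I s* ≤ value I s
  IsMaximal {I} s* = ∀ s → value I s ≤ value I s*

  PolyTimeAlgorithm : ((I : Instance) → Solution I → Set) → Set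
  PolyTimeAlgorithm Acceptable =
    Σ (Prog inTy outTy) λ f → ∃[ c ] ∃[ d ] ∀ I →
      Σ (Solution I) λ s → ∃[ t ]
        (f ⊢ encode I ⇓ encodeSolution s ∣ t)
        × t ℕ.≤ c ℕ.* size inTy (encode I) ^ d ℕ.+ c
        × Acceptable I s

  PolyTimeMinApprox PolyTimeMaxApprox : ℝ → Set
  PolyTimeMinApprox ρ = PolyTimeAlgorithm λ I s →
    ∀ s* → IsMinimal s* → value I s ≤ ρ · value I s*
  PolyTimeMaxApprox ρ = PolyTimeAlgorithm λ I s →
    ∀ s* → IsMaximal s* → ρ · value I s* ≤ value I s

-- For non-negative rationals only, so the sign is dropped.  Fractions need not
-- be in lowest terms.
encodeℚ⁺ : ℚᵘ → ⟦ nat ⊗ nat ⟧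
encodeℚ⁺ q = ℤ.∣ ↥ q ∣ , ↧ₙ q

sumList : List ℚᵘ → ℚᵘ
sumList = List.foldr ℚᵘ._+_ 0ℚᵘ

------------------------------------------------------------------------

record SM2Instance : Set where
  field
    n         : ℕ
    p         : Fin n → ℚᵘ
    p≥0       : ∀ j → 0ℚᵘ ≤ p j
    scenarios : List (Subset n)

  load : Subset n → ℚᵘ
  load S = sum λ j → if lookup S j then p j else 0ℚᵘ

  makespan : Subset n → Subset n → ℚᵘ
  makespan A S = load (A ∩ S) ⊔ load (∁ A ∩ S)

  totalMakespan : Subset n → ℚᵘ
  totalMakespan A = sumList (List.map (makespan A) scenarios)

SM2 : OptProblem
SM2 = record
  { Instance       = SM2Instance
  ; Solution       = λ I → Subset (SM2Instance.n I)
  ; value          = SM2Instance.totalMakespan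
  ; inTy           = list (nat ⊗ nat) ⊗ list (list bool)
  ; outTy          = list bool
  ; encode         = λ I → let open SM2Instance I in
      List.tabulate (λ j → encodeℚ⁺ (p j)) , List.map Vec.toList scenarios
  ; encodeSolution = Vec.toList
  }

AtMostThreeJobs : SM2Instance → Set
AtMostThreeJobs I = All (λ S → ∣ S ∣ ℕ.≤ 3) (SM2Instance.scenarios I)

------------------------------------------------------------------------

-- Graphs have no loops, but may have parallel edges.
record Edge (n : ℕ) : Set where
  field
    u v      : Fin n
    u≢v      : u ≢ v
    weight   : ℚᵘ
    weight≥0 : 0ℚᵘ ≤ weight

record Graph : Set where
  field
    n     : ℕ
    edges : List (Edge n)

  cutWeight : Subset n → ℚᵘ
  cutWeight A = sumList (List.map contribution edges)
    where
    contribution : Edge n → ℚᵘ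
    contribution e =
      if lookup A u xor lookup A v then weight else 0ℚᵘ
      where open Edge e

encodeEdge : ∀ {n} → Edge n → ⟦ (nat ⊗ nat) ⊗ (nat ⊗ nat) ⟧
encodeEdge e = (toℕ u , toℕ v) , encodeℚ⁺ weight
  where open Edge e

-- The vertices are listed explicitly, so the input size is at least n.
MaxCut : OptProblem
MaxCut = record
  { Instance       = Graph
  ; Solution       = λ G → Subset (Graph.n G)
  ; value          = Graph.cutWeight
  ; inTy           = list nat ⊗ list ((nat ⊗ nat) ⊗ (nat ⊗ nat))
  ; outTy          = list bool
  ; encode         = λ G → let open Graph G in
      List.tabulate {n = n} toℕ , List.map encodeEdge edges
  ; encodeSolution = Vec.toList
  }

{-# OPTIONS --safe #-}

-- For a scenario S of at most three jobs and a partition (A, Ā), put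
-- l = p(A ∩ S) and r = p(Ā ∩ S).  Then max(l, r) + min(l, r) = p(S), and
-- min(l, r) is the weight of a cut in a weighted triangle (or edge) on S: the
-- triangle must cut min(x, y + z) whenever the job of length x is separated
-- from those of lengths y and z, and the solution of these three equations is
-- non-negative by the triangle inequality.  With all these edges in one graph,
-- the sum of makespans is P - cut for a constant P, and cut ≤ sum of makespans.
-- So a cut of at least (1 - γ) cut* gives P - cut ≤ opt + γ cut* ≤ (1 + γ) opt.
--
-- The reduction runs in polynomial time because polynomial-time functions are
-- closed under composition, pairing, case distinction and folds whose
-- intermediate states are polynomially bounded.
module Submission where

open import Defs
open import Algebra.Bundles using (CommutativeMonoid)
open import Algebra.Properties.CommutativeSemigroup using (interchange)
open import Data.Bool.Base using (Bool; true; false; if_then_else_; _xor_; not)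
import Data.Fin.Properties as Fin
open import Data.Fin.Base using (Fin; zero; suc; toℕ)
open import Data.Fin.Subset using (Subset; _∩_; ∁; ∣_∣)
import Data.Integer.Base as ℤ
import Data.Integer.Properties as ℤ
import Data.Integer.Tactic.RingSolver as ℤ-RingSolver
open import Data.List.Base as List
  using (List; []; _∷_; [_]; _++_; _ʳ++_; foldl; reverse; concatMap; map; length; tabulate)
import Data.List.Properties as List
open import Data.List.Relation.Binary.Pointwise using (Pointwise; []; _∷_)
open import Data.List.Relation.Unary.All using (All; []; _∷_; universal)
import Data.List.Relation.Unary.All.Properties as All
open import Data.List.Relation.Unary.AllPairs using ([]; _∷_)
open import Data.List.Relation.Unary.Unique.Propositional using (Unique)
import Data.List.Relation.Unary.Unique.Propositional.Properties as Unique
open import Data.Nat.Base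
open import Data.Nat.Induction using (<-wellFounded)
open import Data.Nat.ListAction using (sum)
open import Data.Nat.Logarithm using (⌊log₂_⌋; ⌊log₂⌋-mono-≤; ⌊log₂[2^n]⌋≡n)
open import Data.Nat.Logarithm.Core using (⌊log2⌋)
open import Data.Nat.Properties
open import Data.Nat.Tactic.RingSolver using (solve-∀)
open import Data.Product.Base using (∃-syntax; _×_; _,_; proj₁; proj₂)
open import Data.Rational.Unnormalised.Base as ℚᵘ
  using (ℚᵘ; 0ℚᵘ; 1ℚᵘ; _≃_; ↥_; ↧ₙ_; mkℚᵘ; *≡*; *≤*)
import Data.Rational.Unnormalised.Properties as ℚᵘ
open import Data.Rational.Unnormalised.Solver using (module +-*-Solver)
open import Data.Sum.Base using (inj₁; inj₂)
open import Data.Vec.Base as Vec using ([]; _∷_; lookup)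
import Data.Vec.Properties as Vec
open import Function.Base using (_∘_)
open import Function.Bundles using (Equivalence)
open import Induction.WellFounded as WF using (Acc)
open import Relation.Binary.PropositionalEquality hiding ([_])

open import Algebra.Properties.CommutativeMonoid.Sum ℚᵘ.+-0-commutativeMonoid
  using () renaming (sum to sumFin)
open CommutativeMonoid ℚᵘ.+-0-commutativeMonoid
  using () renaming (commutativeSemigroup to ℚᵘ-+-commutativeSemigroup)

private variable
  A B C S X : Ty

-- Size of numbers

n<2^[1+⌊log₂n⌋] : ∀ n → n < 2 ^ suc ⌊log₂ n ⌋
n<2^[1+⌊log₂n⌋] n = go n (<-wellFounded n)
  where
  -- The logarithm unfolds only along its accessibility argument, so the induction carries an
  -- arbitrary one. Halving costs one factor 2, and `⌈ n /2⌉` exceeds `⌊ n /2⌋` by at most 1.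
  go : ∀ n (a : Acc _<_ n) → n < 2 ^ suc (⌊log2⌋ n a)
  go zero          _        = s≤s z≤n
  go (suc zero)    _        = s≤s (s≤s z≤n)
  go (suc (suc n)) (WF.acc rs) = begin-strict
    2 + n                             ≡⟨ cong (2 +_) (sym (⌊n/2⌋+⌈n/2⌉≡n n)) ⟩
    2 + (⌊ n /2⌋ + ⌈ n /2⌉)           ≤⟨ +-monoʳ-≤ (2 + ⌊ n /2⌋) (⌊n/2⌋-mono (n≤1+n (suc n))) ⟩
    2 + (⌊ n /2⌋ + suc ⌊ n /2⌋)       <⟨ n<1+n _ ⟩
    3 + (⌊ n /2⌋ + suc ⌊ n /2⌋)       ≡⟨ double ⌊ n /2⌋ ⟩
    2 * (2 + ⌊ n /2⌋)                 ≤⟨ *-monoʳ-≤ 2 (go (suc ⌊ n /2⌋) _) ⟩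
    2 * 2 ^ suc (⌊log2⌋ (suc ⌊ n /2⌋) _) ∎
    where
    open ≤-Reasoning
    double : ∀ h → 3 + (h + suc h) ≡ 2 * (2 + h)
    double = solve-∀

⌊log₂⌋-≤ : ∀ {n} e → n ≤ 2 ^ e → ⌊log₂ n ⌋ ≤ e
⌊log₂⌋-≤ e n≤2^e = ≤-trans (⌊log₂⌋-mono-≤ n≤2^e) (≤-reflexive (⌊log₂[2^n]⌋≡n e))

-- Serves sums as well as products. The exponents add, and the 1 that a pair adds to its size pays
-- for the 1 in `size nat k`.
size-product : ∀ m n k → k ≤ 2 ^ size nat m * 2 ^ size nat n →
  size nat k ≤ size (nat ⊗ nat) (m , n)
size-product m n k k≤ = s≤s (⌊log₂⌋-≤ (size nat m + size nat n)
  (≤-trans k≤ (≤-reflexive (sym (^-distribˡ-+-* 2 (size nat m) (size nat n))))))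

size-* : ∀ m n → size nat (m * n) ≤ size (nat ⊗ nat) (m , n)
size-* m n = size-product m n (m * n)
  (*-mono-≤ (<⇒≤ (n<2^[1+⌊log₂n⌋] m)) (<⇒≤ (n<2^[1+⌊log₂n⌋] n)))

size-+ : ∀ m n → size nat (m + n) ≤ size (nat ⊗ nat) (m , n)
size-+ m n = size-product m n (m + n) (≤-trans
  (+-mono-≤ (<⇒≤ (n<2^[1+⌊log₂n⌋] m)) (<⇒≤ (n<2^[1+⌊log₂n⌋] n)))
  (double (2 ^ ⌊log₂ m ⌋) (2 ^ ⌊log₂ n ⌋) {{m^n≢0 2 ⌊log₂ m ⌋}} {{m^n≢0 2 ⌊log₂ n ⌋}}))
  where
  double : ∀ a b .{{_ : NonZero a}} .{{_ : NonZero b}} → 2 * a + 2 * b ≤ 2 * a * (2 * b)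
  double (suc a) (suc b) =
    ≤-trans (m≤m+n _ (2 * a + 2 * b + 4 * (a * b))) (≤-reflexive (eq a b))
    where
    eq : ∀ a b → 2 * suc a + 2 * suc b + (2 * a + 2 * b + 4 * (a * b)) ≡ 2 * suc a * (2 * suc b)
    eq = solve-∀

size-nat-≤ : ∀ n → size nat n ≤ suc n
size-nat-≤ n = s≤s (⌊log₂⌋-≤ n (n≤2^n n))
  where
  n≤2^n : ∀ n → n ≤ 2 ^ n
  n≤2^n zero    = z≤n
  n≤2^n (suc n) = +-mono-≤ (m^n>0 2 n) (≤-trans (n≤2^n n) (m≤m+n (2 ^ n) 0))

size>0 : ∀ A x → 0 < size A x
size>0 bool     _        = z<s
size>0 nat      _        = z<s
size>0 (A ⊗ B)  _        = z<s
size>0 (list A) []       = z<s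
size>0 (list A) (_ ∷ _)  = z<s

size-length : ∀ A xs → length xs ≤ size (list A) xs
size-length A []       = z≤n
size-length A (x ∷ xs) = s≤s (≤-trans (size-length A xs) (m≤n+m _ (size A x)))

size-++ : ∀ A xs ys → size (list A) xs ≤ size (list A) (xs ++ ys)
size-++ A []       ys = size>0 (list A) ys
size-++ A (x ∷ xs) ys = +-monoʳ-≤ (suc (size A x)) (size-++ A xs ys)

-- Each list size counts 1 for its closing `[]`, and only one of the two survives in the result;
-- hence the `suc`.
size-ʳ++ : ∀ A xs ys → suc (size (list A) (xs ʳ++ ys)) ≡ size (list A) xs + size (list A) ys
size-ʳ++ A []       ys = refl
size-ʳ++ A (x ∷ xs) ys = trans (size-ʳ++ A xs (x ∷ ys))
  (eq (size (list A) xs) (size A x) (size (list A) ys))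
  where
  eq : ∀ a b c → a + (1 + b + c) ≡ 1 + b + a + c
  eq = solve-∀

-- Polynomials

infixl 6 _⊕_
infixl 7 _⊛_

-- Coefficients are natural numbers, so every bound is monotone; kept as syntax, bounds can be
-- substituted into each other.
data Poly : Set where
  const     : ℕ → Poly
  var     : Poly
  _⊕_ _⊛_ : Poly → Poly → Poly

eval : Poly → ℕ → ℕ
eval (const k) n = k
eval var     n = n
eval (P ⊕ Q) n = eval P n + eval Q n
eval (P ⊛ Q) n = eval P n * eval Q n

eval-mono : ∀ P {m n} → m ≤ n → eval P m ≤ eval P n
eval-mono (const k) _   = ≤-refl
eval-mono var     m≤n = m≤n
eval-mono (P ⊕ Q) m≤n = +-mono-≤ (eval-mono P m≤n) (eval-mono Q m≤n)
eval-mono (P ⊛ Q) m≤n = *-mono-≤ (eval-mono P m≤n) (eval-mono Q m≤n)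

infixr 8 _⊙_

_⊙_ : Poly → Poly → Poly
const k   ⊙ R = const k
var     ⊙ R = R
(P ⊕ Q) ⊙ R = P ⊙ R ⊕ Q ⊙ R
(P ⊛ Q) ⊙ R = P ⊙ R ⊛ Q ⊙ R

eval-⊙ : ∀ P R n → eval (P ⊙ R) n ≡ eval P (eval R n)
eval-⊙ (const k) R n = refl
eval-⊙ var     R n = refl
eval-⊙ (P ⊕ Q) R n = cong₂ _+_ (eval-⊙ P R n) (eval-⊙ Q R n)
eval-⊙ (P ⊛ Q) R n = cong₂ _*_ (eval-⊙ P R n) (eval-⊙ Q R n)

power : ℕ → Poly
power zero    = const 1
power (suc d) = var ⊛ power d

eval-power : ∀ d n → eval (power d) n ≡ n ^ d
eval-power zero    n = refl
eval-power (suc d) n = cong (n *_) (eval-power d n)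

-- Yields the monomial form used in `PolyTimeAlgorithm`. In a sum both exponents are raised to
-- `d + d′`, which calls for `n` positive.
eval-bound : ∀ P → ∃[ c ] ∃[ d ] ∀ n → 0 < n → eval P n ≤ c * n ^ d
eval-bound (const k) = k , 0 , λ n _ → ≤-reflexive (sym (*-identityʳ k))
eval-bound var     = 1 , 1 , λ n _ → ≤-reflexive (sym (trans (*-identityˡ (n ^ 1)) (^-identityʳ n)))
eval-bound (P ⊕ Q) with eval-bound P | eval-bound Q
... | c , d , P≤ | c′ , d′ , Q≤ = c + c′ , d + d′ , λ n n>0 →
  let instance _ = >-nonZero n>0 in begin
    eval P n + eval Q n                  ≤⟨ +-mono-≤ (P≤ n n>0) (Q≤ n n>0) ⟩
    c * n ^ d + c′ * n ^ d′              ≤⟨ +-mono-≤ (*-monoʳ-≤ c (^-monoʳ-≤ n (m≤m+n d d′)))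
                                                     (*-monoʳ-≤ c′ (^-monoʳ-≤ n (m≤n+m d′ d))) ⟩
    c * n ^ (d + d′) + c′ * n ^ (d + d′) ≡⟨ sym (*-distribʳ-+ (n ^ (d + d′)) c c′) ⟩
    (c + c′) * n ^ (d + d′)              ∎
  where open ≤-Reasoning
eval-bound (P ⊛ Q) with eval-bound P | eval-bound Q
... | c , d , P≤ | c′ , d′ , Q≤ = c * c′ , d + d′ , λ n n>0 → begin
    eval P n * eval Q n         ≤⟨ *-mono-≤ (P≤ n n>0) (Q≤ n n>0) ⟩
    c * n ^ d * (c′ * n ^ d′)   ≡⟨ eq c (n ^ d) c′ (n ^ d′) ⟩
    c * c′ * (n ^ d * n ^ d′)   ≡⟨ cong (c * c′ *_) (sym (^-distribˡ-+-* n d d′)) ⟩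
    c * c′ * n ^ (d + d′)       ∎
  where
  open ≤-Reasoning
  eq : ∀ a b c d → a * b * (c * d) ≡ a * c * (b * d)
  eq = solve-∀

-- Polynomial-time computable functions

-- One number bounds both the cost and the output size: the latter is the input size of the next
-- program in a composition.
record Halts (f : Prog A B) (x : ⟦ A ⟧) (y : ⟦ B ⟧) (b : ℕ) : Set where
  constructor halt
  field
    {cost} : ℕ
    run    : f ⊢ x ⇓ y ∣ cost
    cost≤  : cost ≤ b
    size≤  : size B y ≤ b

record Computable (A B : Ty) (f : ⟦ A ⟧ → ⟦ B ⟧) : Set where
  field
    program : Prog A B
    bound   : Poly
    halts   : ∀ x → Halts program x (f x) (eval bound (size A x))

open Computable

-- A literal is the only operation whose output can be larger than its argument.
opBound : (o : Op A B) → ℕ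
opBound {B = B} (lit y) = size B y
opBound _               = 0

size-op : (o : Op A B) (x : ⟦ A ⟧) → size B (⟦ o ⟧ₒ x) ≤ 1 + size A x + opBound o
size-op {A} {B} o x = ≤-trans (go o x) (s≤s (≤-refl {size A x + opBound o}))
  where
  weaken : ∀ {a} k m → a ≤ m → a ≤ 1 + (m + k)
  weaken k m p = m≤n⇒m≤1+n (m≤n⇒m≤n+o k p)
  go : ∀ {A B} (o : Op A B) (x : ⟦ A ⟧) → size B (⟦ o ⟧ₒ x) ≤ 1 + (size A x + opBound o)
  go id x                        = weaken 0 _ ≤-refl
  go {A} {B} (lit y) x           = m≤n⇒m≤1+n (m≤n+m (size B y) (size A x))
  go {A ⊗ B} fst (x , y)         = weaken 0 _ (m≤n⇒m≤1+n (m≤m+n (size A x) (size B y)))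
  go {A ⊗ B} snd (x , y)         = weaken 0 _ (m≤n⇒m≤1+n (m≤n+m (size B y) (size A x)))
  go cons (x , xs)               = weaken 0 _ ≤-refl
  go add (m , n)                 = weaken 0 _ (size-+ m n)
  go monus (m , n)               = weaken 0 _
    (m≤n⇒m≤1+n (m≤n⇒m≤n+o (size nat n) (s≤s (⌊log₂⌋-mono-≤ (m∸n≤m m n)))))
  go mul (m , n)                 = weaken 0 _ (size-* m n)
  go leq (m , n)                 = s≤s z≤n

opᶜ : (o : Op A B) → Computable A B ⟦ o ⟧ₒ
opᶜ {A} {B} o = record
  { program = op o
  ; bound   = const 1 ⊕ var ⊕ const (opBound o)
  ; halts   = λ x → halt run-op (m≤m+n (1 + size A x) _) (size-op o x)
  }

comp : ∀ {f g} → Computable A B f → Computable B C g → Computable A C (g ∘ f)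
comp {A = A} {B = B} {C = C} {f} {g} F G = record
  { program = program F ⨾ program G
  ; bound   = bound F ⊕ bound G ⊙ bound F
  ; halts   = λ x → let
      halt r r≤ s≤ = halts F x
      halt r′ r′≤ s′≤ = halts G (f x)
      le : eval (bound G) (size B (f x)) ≤ eval (bound G ⊙ bound F) (size A x)
      le = ≤-trans (eval-mono (bound G) s≤)
        (≤-reflexive (sym (eval-⊙ (bound G) (bound F) (size A x))))
      in halt (run-⨾ r r′) (+-mono-≤ r≤ (≤-trans r′≤ le)) (m≤n⇒m≤o+n _ (≤-trans s′≤ le))
  }

pair : ∀ {f g} → Computable A B f → Computable A C g → Computable A (B ⊗ C) (λ x → f x , g x)
pair F G = record
  { program = ⟨ program F , program G ⟩
  ; bound   = const 1 ⊕ bound F ⊕ bound G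
  ; halts   = λ x → let
      halt r r≤ s≤ = halts F x
      halt r′ r′≤ s′≤ = halts G x
      in halt (run-⟨,⟩ r r′) (m≤n⇒m≤1+n (+-mono-≤ r≤ r′≤)) (s≤s (+-mono-≤ s≤ s′≤))
  }

condᶜ : ∀ {c f g} → Computable A bool c → Computable A B f → Computable A B g →
  Computable A B (λ x → if c x then f x else g x)
condᶜ {A} {B} {c} {f} {g} H F G = record
  { program = cond (program H) (program F) (program G)
  ; bound   = bound H ⊕ (bound F ⊕ bound G)
  ; halts   = go
  }
  where
  go : ∀ x → Halts (cond (program H) (program F) (program G)) x (if c x then f x else g x)
    (eval (bound H ⊕ (bound F ⊕ bound G)) (size A x))
  go x with c x | halts H x | halts F x | halts G x
  ... | true  | halt r r≤ _ | halt r′ r′≤ s≤ | _ =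
    halt (run-true r r′) (+-mono-≤ r≤ (m≤n⇒m≤n+o _ r′≤))
      (m≤n⇒m≤o+n (eval (bound H) (size A x)) (m≤n⇒m≤n+o _ s≤))
  ... | false | halt r r≤ _ | _ | halt r′ r′≤ s≤ =
    halt (run-false r r′) (+-mono-≤ r≤ (m≤n⇒m≤o+n _ r′≤))
      (m≤n⇒m≤o+n (eval (bound H) (size A x)) (m≤n⇒m≤o+n (eval (bound F) (size A x)) s≤))

listCase : {X Y Z : Set} → (Z → Y) → ((X × List X) × Z → Y) → List X × Z → Y
listCase f g ([]     , z) = f z
listCase f g (x ∷ xs , z) = g ((x , xs) , z)

caseᶜ : ∀ {f g} → Computable C B f → Computable ((A ⊗ list A) ⊗ C) B g →
  Computable (list A ⊗ C) B (listCase f g)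
caseᶜ {C} {B} {A} {f} {g} F G = record
  { program = caseList (program F) (program G)
  ; bound   = const 1 ⊕ var ⊕ (bound F ⊕ bound G)
  ; halts   = λ where
      ([] , z) → let
        halt r r≤ s≤ = halts F z
        le : ∀ {t} → t ≤ eval (bound F) (size C z) →
          t ≤ eval (bound F ⊕ bound G) (size (list A ⊗ C) ([] , z))
        le p = m≤n⇒m≤n+o _ (≤-trans p (eval-mono (bound F) (m≤n+m (size C z) 2)))
        in halt (run-[] r) (+-monoʳ-≤ _ (le r≤))
             (m≤n⇒m≤o+n (1 + size (list A ⊗ C) ([] , z)) (le s≤))
      (x ∷ xs , z) → let
        halt r r≤ s≤ = halts G ((x , xs) , z)
        le : ∀ {t} → t ≤ eval (bound G) (size ((A ⊗ list A) ⊗ C) ((x , xs) , z)) →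
          t ≤ eval (bound F ⊕ bound G) (size (list A ⊗ C) (x ∷ xs , z))
        le p = m≤n⇒m≤o+n _ p
        in halt (run-∷ r) (+-monoʳ-≤ _ (le r≤))
             (m≤n⇒m≤o+n (1 + size (list A ⊗ C) (x ∷ xs , z)) (le s≤))
  }

computable-cong : ∀ {f g} → (∀ x → f x ≡ g x) → Computable A B f → Computable A B g
computable-cong {f = f} {g} f≗g F = record
  { program = program F
  ; bound   = bound F
  ; halts   = λ x → subst (λ y → Halts (program F) x y _) (f≗g x) (halts F x)
  }

nonEmptyᶜ : Computable (list A ⊗ S) bool (listCase (λ _ → false) (λ _ → true))
nonEmptyᶜ = caseᶜ (opᶜ (lit false)) (opᶜ (lit true))

-- Left folds as loops

module Fold {A S : Ty} (step : ⟦ S ⟧ → ⟦ A ⟧ → ⟦ S ⟧)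
  (stepᶜ : Computable (A ⊗ S) S (λ (x , s) → step s x)) where

  advanceᶜ : Computable (list A ⊗ S) (list A ⊗ S)
    (listCase ([] ,_) (λ ((x , xs) , s) → xs , step s x))
  -- The branch for the empty list is a default; the loop guard admits only non-empty lists.
  advanceᶜ = caseᶜ (pair (opᶜ (lit [])) (opᶜ id))
    (pair (comp (opᶜ fst) (opᶜ snd)) (comp (pair (comp (opᶜ fst) (opᶜ fst)) (opᶜ snd)) stepᶜ))

  loop : Prog (list A ⊗ S) (list A ⊗ S)
  loop = while (program nonEmptyᶜ) (program advanceᶜ)

  roundBound : Poly
  roundBound = bound (nonEmptyᶜ {A} {S}) ⊕ bound advanceᶜ

  -- `M` bounds every state reached after a prefix `ys` of the input. There is one round per entry
  -- and one last failing test, each within `roundBound` at `M`; hence the factor `suc (length xs)`.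
  loop-run : ∀ xs s M → (∀ ys zs → xs ≡ ys ++ zs → size (list A ⊗ S) (zs , foldl step s ys) ≤ M) →
    ∃[ t ] (loop ⊢ (xs , s) ⇓ ([] , foldl step s xs) ∣ t) × t ≤ suc (length xs) * eval roundBound M
  loop-run [] s M small = cost c , run-stop (run c) ,
    m≤n⇒m≤n+o 0 (m≤n⇒m≤n+o _ (≤-trans (cost≤ c)
      (eval-mono (bound (nonEmptyᶜ {A} {S})) (small [] [] refl))))
    where
    open Halts
    c : Halts _ _ _ _
    c = halts (nonEmptyᶜ {A} {S}) ([] , s)
  loop-run (x ∷ xs) s M small =
    let t , r , t≤ = loop-run xs (step s x) M (λ ys zs eq → small (x ∷ ys) zs (cong (x ∷_) eq))
    in cost c + cost b + t , run-step (run c) (run b) r ,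
       +-mono-≤ (+-mono-≤
         (≤-trans (cost≤ c) (eval-mono (bound (nonEmptyᶜ {A} {S})) (small [] (x ∷ xs) refl)))
         (≤-trans (cost≤ b) (eval-mono (bound advanceᶜ) (small [] (x ∷ xs) refl)))) t≤
    where
    open Halts
    c : Halts _ _ _ _
    c = halts (nonEmptyᶜ {A} {S}) (x ∷ xs , s)
    b : Halts _ _ _ _
    b = halts advanceᶜ (x ∷ xs , s)

  -- A polynomial-time step may double its state, and iterating it would be exponential. `growth`
  -- excludes this by bounding the state after each prefix in terms of the original input.
  foldlᶜ : {l : ⟦ X ⟧ → List ⟦ A ⟧} {s₀ : ⟦ X ⟧ → ⟦ S ⟧} →
    Computable X (list A) l → Computable X S s₀ →
    (G : Poly) → (∀ x ys zs → l x ≡ ys ++ zs → size S (foldl step (s₀ x) ys) ≤ eval G (size X x)) →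
    Computable X S (λ x → foldl step (s₀ x) (l x))
  foldlᶜ {X} {l} {s₀} L I G growth = record
    { program = ⟨ program L , program I ⟩ ⨾ loop ⨾ op snd
    ; bound   = (bound L ⊕ bound I) ⊕
        ((const 1 ⊕ bound L) ⊛ roundBound ⊙ stateBound ⊕ (const 1 ⊕ stateBound))
    ; halts   = λ x → let
        module L = Halts (halts L x)
        module I = Halts (halts I x)
        N = size X x
        M = eval stateBound N
        small : ∀ ys zs → l x ≡ ys ++ zs → size (list A ⊗ S) (zs , foldl step (s₀ x) ys) ≤ M
        small ys zs eq = s≤s (+-mono-≤
          (≤-trans (≤-trans (size-++ʳ A ys zs)
                            (≤-reflexive (cong (size (list A)) (sym eq)))) L.size≤)
          (growth x ys zs eq))
        small-end : size (list A ⊗ S) ([] , foldl step (s₀ x) (l x)) ≤ M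
        small-end = small (l x) [] (sym (List.++-identityʳ (l x)))
        t , r , t≤ = loop-run (l x) (s₀ x) M small
        t≤′ : t ≤ (1 + eval (bound L) N) * eval (roundBound ⊙ stateBound) N
        t≤′ = ≤-trans t≤ (*-mono-≤ (s≤s (≤-trans (size-length A (l x)) L.size≤))
          (≤-reflexive (sym (eval-⊙ roundBound stateBound N))))
        in halt (run-⨾ (run-⟨,⟩ L.run I.run) (run-⨾ r run-op))
             (+-mono-≤ (+-mono-≤ L.cost≤ I.cost≤) (+-mono-≤ t≤′ (s≤s small-end)))
             (m≤n⇒m≤o+n (eval (bound L ⊕ bound I) N)
               (m≤n⇒m≤o+n (eval ((const 1 ⊕ bound L) ⊛ roundBound ⊙ stateBound) N)
                 (m≤n⇒m≤1+n (≤-trans (m≤n+m _ 2) small-end))))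
    }
    where
    stateBound : Poly
    stateBound = const 1 ⊕ (bound L ⊕ G)
    size-++ʳ : ∀ A ys zs → size (list A) zs ≤ size (list A) (ys ++ zs)
    size-++ʳ A []       zs = ≤-refl
    size-++ʳ A (y ∷ ys) zs = m≤n⇒m≤o+n (suc (size A y)) (size-++ʳ A ys zs)

open Fold using (foldlᶜ) public

-- List operations in polynomial time

fstᶜ : Computable (A ⊗ B) A proj₁
fstᶜ = opᶜ fst

sndᶜ : Computable (A ⊗ B) B proj₂
sndᶜ = opᶜ snd

idᶜ : Computable A A (λ x → x)
idᶜ = opᶜ id

litᶜ : (y : ⟦ B ⟧) → Computable A B (λ _ → y)
litᶜ y = opᶜ (lit y)

infixr 5 _∷ᶜ_

_∷ᶜ_ : ∀ {f g} → Computable A B f → Computable A (list B) g →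
  Computable A (list B) (λ x → f x ∷ g x)
F ∷ᶜ G = comp (pair F G) (opᶜ cons)

-- Consing onto an accumulator reverses, so this is the append that a left fold gives directly. The
-- constructions below accumulate backwards and reverse once at the end.
_ʳ++ᶜ_ : ∀ {f g} → Computable A (list B) f → Computable A (list B) g →
  Computable A (list B) (λ x → f x ʳ++ g x)
_ʳ++ᶜ_ {A} {B} {f} {g} F G = foldlᶜ (λ ys y → y ∷ ys) (opᶜ cons) F G (bound F ⊕ bound G)
  (λ x ys zs eq → let
    open ≤-Reasoning
    in begin
    size (list B) (ys ʳ++ g x)              ≤⟨ n≤1+n _ ⟩
    suc (size (list B) (ys ʳ++ g x))        ≡⟨ size-ʳ++ B ys (g x) ⟩
    size (list B) ys + size (list B) (g x)  ≤⟨ +-monoˡ-≤ _ (size-++ B ys zs) ⟩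
    size (list B) (ys ++ zs) + size (list B) (g x)
      ≡⟨ cong (λ xs → size (list B) xs + size (list B) (g x)) (sym eq) ⟩
    size (list B) (f x) + size (list B) (g x)
      ≤⟨ +-mono-≤ (Halts.size≤ (halts F x)) (Halts.size≤ (halts G x)) ⟩
    eval (bound F ⊕ bound G) (size A x)     ∎)

reverseᶜ : ∀ {f} → Computable A (list B) f → Computable A (list B) (λ x → reverse (f x))
reverseᶜ F = F ʳ++ᶜ litᶜ []

-- An entry is no larger than its list, so a polynomial bound for `h` at that size covers all pieces
-- at once. The summand 1 is the closing `[]`.
size-concatMap : ∀ A B (h : ⟦ A ⟧ → List ⟦ B ⟧) H ys →
  (∀ y → size A y ≤ size (list A) ys → size (list B) (h y) ≤ H) →
  size (list B) (concatMap h ys) ≤ 1 + length ys * H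
size-concatMap A B h H []       small = ≤-refl
size-concatMap A B h H (y ∷ ys) small = begin
  size (list B) (h y ++ concatMap h ys)    ≤⟨ size-++-≤ (h y) (concatMap h ys) ⟩
  size (list B) (h y) + size (list B) (concatMap h ys)
    ≤⟨ +-mono-≤ (small y (m≤n⇒m≤1+n (m≤m+n _ _)))
         (size-concatMap A B h H ys λ z z≤ → small z (m≤n⇒m≤o+n (suc (size A y)) z≤)) ⟩
  H + (1 + length ys * H)                  ≡⟨ +-suc H _ ⟩
  1 + (H + length ys * H)                  ∎
  where
  open ≤-Reasoning
  size-++-≤ : ∀ us vs → size (list B) (us ++ vs) ≤ size (list B) us + size (list B) vs
  size-++-≤ []       vs = n≤1+n _
  size-++-≤ (u ∷ us) vs = ≤-trans (+-monoʳ-≤ (suc (size B u)) (size-++-≤ us vs))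
    (≤-reflexive (sym (+-assoc (suc (size B u)) _ _)))

-- The environment travels as the second component of the folded state.
concatMapᶜ : ∀ {h : ⟦ A ⊗ X ⟧ → List ⟦ B ⟧} {f} →
  Computable X (list A) f → Computable (A ⊗ X) (list B) h →
  Computable X (list B) (λ x → concatMap (λ a → h (a , x)) (f x))
concatMapᶜ {A} {X} {B} {h} {f} F H = computable-cong
  (λ x → trans (cong (λ (zs , _) → reverse zs) (state x (f x) []))
               (List.reverse-involutive (concatMap (λ a → h (a , x)) (f x))))
  (reverseᶜ (comp folded fstᶜ))
  where
  step : List ⟦ B ⟧ × ⟦ X ⟧ → ⟦ A ⟧ → List ⟦ B ⟧ × ⟦ X ⟧
  step (acc , x) a = h (a , x) ʳ++ acc , x

  stepᶜ : Computable (A ⊗ (list B ⊗ X)) (list B ⊗ X) (λ (a , s) → step s a)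
  stepᶜ = pair (comp (pair fstᶜ (comp sndᶜ sndᶜ)) H ʳ++ᶜ comp sndᶜ fstᶜ) (comp sndᶜ sndᶜ)

  state : ∀ x ys acc → foldl step (acc , x) ys ≡ (concatMap (λ a → h (a , x)) ys ʳ++ acc , x)
  state x []       acc = refl
  state x (y ∷ ys) acc = trans (state x ys (h (y , x) ʳ++ acc))
    (cong (_, x) (sym (List.++-ʳ++ (h (y , x)))))

  outputBound stateBound : Poly
  -- The inner polynomial bounds the size of a pair `(y , x)` with `y` an entry of `f x`.
  outputBound = bound H ⊙ (const 1 ⊕ bound F ⊕ var)
  stateBound = const 1 ⊕ (const 1 ⊕ bound F ⊛ outputBound) ⊕ var

  growth : ∀ x ys zs → f x ≡ ys ++ zs →
    size (list B ⊗ X) (foldl step ([] , x) ys) ≤ eval stateBound (size X x)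
  growth x ys zs eq = begin
    size (list B ⊗ X) (foldl step ([] , x) ys) ≡⟨ cong (size (list B ⊗ X)) (state x ys []) ⟩
    1 + size (list B) (reverse out) + size X x ≡⟨ cong (λ k → 1 + k + size X x) size-out ⟩
    1 + size (list B) out + size X x
      ≤⟨ +-monoˡ-≤ (size X x) (s≤s (size-concatMap A B (λ a → h (a , x)) K ys small)) ⟩
    1 + (1 + length ys * K) + size X x
      ≤⟨ +-monoˡ-≤ (size X x) (s≤s (s≤s (*-monoˡ-≤ K (≤-trans (size-length A ys) ys≤)))) ⟩
    1 + (1 + eval (bound F) (size X x) * K) + size X x ∎
    where
    open ≤-Reasoning
    out : List ⟦ B ⟧
    out = concatMap (λ a → h (a , x)) ys
    K : ℕ
    K = eval outputBound (size X x)
    size-out : size (list B) (reverse out) ≡ size (list B) out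
    size-out = suc-injective (trans (size-ʳ++ B out []) (+-comm _ 1))
    ys≤ : size (list A) ys ≤ eval (bound F) (size X x)
    ys≤ = ≤-trans (size-++ A ys zs) (≤-trans (≤-reflexive (cong (size (list A)) (sym eq)))
      (Halts.size≤ (halts F x)))
    small : ∀ y → size A y ≤ size (list A) ys → size (list B) (h (y , x)) ≤ K
    small y y≤ = ≤-trans (Halts.size≤ (halts H (y , x)))
      (≤-trans (eval-mono (bound H) (s≤s (+-monoˡ-≤ (size X x) (≤-trans y≤ ys≤))))
               (≤-reflexive (sym (eval-⊙ (bound H) (const 1 ⊕ bound F ⊕ var) (size X x)))))

  folded : Computable X (list B ⊗ X) (λ x → foldl step ([] , x) (f x))
  folded = foldlᶜ step stepᶜ F (pair (litᶜ []) idᶜ) stateBound growth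

mapᶜ : ∀ {h : ⟦ A ⊗ X ⟧ → ⟦ B ⟧} {f} → Computable X (list A) f → Computable (A ⊗ X) B h →
  Computable X (list B) (λ x → map (λ a → h (a , x)) (f x))
mapᶜ {h = h} {f} F H = computable-cong
  (λ x → trans (sym (List.concatMap-map [_] (λ a → h (a , x)) (f x)))
               (List.concatMap-pure (map (λ a → h (a , x)) (f x))))
  (concatMapᶜ F (H ∷ᶜ litᶜ []))

enumFrom : {Y : Set} → ℕ → List Y → List (ℕ × Y)
enumFrom k []       = []
enumFrom k (y ∷ ys) = (k , y) ∷ enumFrom (suc k) ys

-- Indices stay below the length of the list, so measuring them by value instead of binary length is
-- still polynomial. Each entry gains 1 for the pair and at most `N` for its index.
size-enumFrom : ∀ A k ys N → k + length ys ≤ N →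
  size (list (nat ⊗ A)) (enumFrom k ys) ≤ size (list A) ys + length ys * suc N
size-enumFrom A k []       N _   = ≤-refl
size-enumFrom A k (y ∷ ys) N k≤N = begin
  1 + (1 + size nat k + size A y) + size (list (nat ⊗ A)) (enumFrom (suc k) ys)
    ≤⟨ +-mono-≤ (s≤s (s≤s (+-monoˡ-≤ (size A y)
                  (≤-trans (size-nat-≤ k) (≤-trans (m≤m+n (suc k) (length ys)) k≤N′)))))
                (size-enumFrom A (suc k) ys N k≤N′) ⟩
  1 + (1 + N + size A y) + (size (list A) ys + length ys * suc N)
    ≡⟨ eq (size A y) (size (list A) ys) (length ys * suc N) N ⟩
  1 + size A y + size (list A) ys + (suc N + length ys * suc N) ∎
  where
  open ≤-Reasoning
  k≤N′ : suc k + length ys ≤ N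
  k≤N′ = ≤-trans (≤-reflexive (sym (+-suc k (length ys)))) k≤N
  eq : ∀ a b c N → 1 + (1 + N + a) + (b + c) ≡ 1 + a + b + (suc N + c)
  eq = solve-∀

enumᶜ : ∀ {f} → Computable X (list A) f → Computable X (list (nat ⊗ A)) (λ x → enumFrom 0 (f x))
enumᶜ {X} {A} {f} F = computable-cong
  (λ x → trans (cong (λ (_ , zs) → reverse zs) (state 0 (f x) []))
               (List.reverse-involutive (enumFrom 0 (f x))))
  (reverseᶜ (comp folded sndᶜ))
  where
  step : ℕ × List (ℕ × ⟦ A ⟧) → ⟦ A ⟧ → ℕ × List (ℕ × ⟦ A ⟧)
  step (k , acc) y = suc k , (k , y) ∷ acc

  stepᶜ : Computable (A ⊗ (nat ⊗ list (nat ⊗ A))) (nat ⊗ list (nat ⊗ A)) (λ (y , s) → step s y)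
  stepᶜ = pair (comp (pair (litᶜ 1) (comp sndᶜ fstᶜ)) (opᶜ add))
               (pair (comp sndᶜ fstᶜ) fstᶜ ∷ᶜ comp sndᶜ sndᶜ)

  state : ∀ k ys acc → foldl step (k , acc) ys ≡ (length ys + k , enumFrom k ys ʳ++ acc)
  state k []       acc = refl
  state k (y ∷ ys) acc = trans (state (suc k) ys ((k , y) ∷ acc))
    (cong (_, enumFrom (suc k) ys ʳ++ (k , y) ∷ acc) (+-suc (length ys) k))

  G : Poly
  G = const 1 ⊕ (const 1 ⊕ bound F) ⊕ (bound F ⊕ bound F ⊛ (const 1 ⊕ bound F))

  growth : ∀ x ys zs → f x ≡ ys ++ zs →
    size (nat ⊗ list (nat ⊗ A)) (foldl step (0 , []) ys) ≤ eval G (size X x)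
  growth x ys zs eq = begin
    size (nat ⊗ list (nat ⊗ A)) (foldl step (0 , []) ys)
      ≡⟨ cong (size (nat ⊗ list (nat ⊗ A))) (state 0 ys []) ⟩
    1 + size nat (length ys + 0) + size (list (nat ⊗ A)) (reverse (enumFrom 0 ys))
      ≡⟨ cong₂ (λ k m → 1 + size nat k + m) (+-identityʳ (length ys))
           (suc-injective (trans (size-ʳ++ (nat ⊗ A) (enumFrom 0 ys) []) (+-comm _ 1))) ⟩
    1 + size nat (length ys) + size (list (nat ⊗ A)) (enumFrom 0 ys)
      ≤⟨ +-mono-≤ (s≤s (≤-trans (size-nat-≤ (length ys)) (s≤s len≤)))
           (≤-trans (size-enumFrom A 0 ys K len≤) (+-mono-≤ ys≤ (*-monoˡ-≤ (suc K) len≤))) ⟩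
    1 + (1 + K) + (K + K * (1 + K)) ∎
    where
    open ≤-Reasoning
    K : ℕ
    K = eval (bound F) (size X x)
    ys≤ : size (list A) ys ≤ K
    ys≤ = ≤-trans (size-++ A ys zs) (≤-trans (≤-reflexive (cong (size (list A)) (sym eq)))
      (Halts.size≤ (halts F x)))
    len≤ : length ys ≤ K
    len≤ = ≤-trans (size-length A ys) ys≤

  folded : Computable X (nat ⊗ list (nat ⊗ A)) (λ x → foldl step (0 , []) (f x))
  folded = foldlᶜ step stepᶜ F (litᶜ (0 , [])) G growth

pick : {Y : Set} → List Bool → List Y → List Y
pick []           ys       = []
pick (b ∷ bs)     []       = []
pick (true ∷ bs)  (y ∷ ys) = y ∷ pick bs ys
pick (false ∷ bs) (y ∷ ys) = pick bs ys

pickᶜ : ∀ {f g} → Computable X (list bool) f → Computable X (list A) g →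
  Computable X (list A) (λ x → pick (f x) (g x))
pickᶜ {X} {A} {f} {g} F G = computable-cong
  (λ x → trans (cong reverse (state (f x) (g x) [])) (List.reverse-involutive (pick (f x) (g x))))
  (reverseᶜ (comp
    (foldlᶜ step stepᶜ F (pair G (litᶜ [])) (const 1 ⊕ bound G ⊕ const 1) growth) sndᶜ))
  where
  step : List ⟦ A ⟧ × List ⟦ A ⟧ → Bool → List ⟦ A ⟧ × List ⟦ A ⟧
  step ([]       , acc) b = [] , acc
  step (y ∷ rest , acc) b = rest , (if b then y ∷ acc else acc)

  stepᶜ : Computable (bool ⊗ (list A ⊗ list A)) (list A ⊗ list A) (λ (b , s) → step s b)
  stepᶜ = computable-cong (λ where
      (b , [] , acc)       → refl
      (b , y ∷ rest , acc) → refl)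
    (comp (pair (comp sndᶜ fstᶜ) idᶜ) (caseᶜ
      (pair (litᶜ []) (comp sndᶜ sndᶜ))
      (pair (comp fstᶜ sndᶜ)
            (condᶜ (comp sndᶜ fstᶜ)
              (comp fstᶜ fstᶜ ∷ᶜ comp sndᶜ (comp sndᶜ sndᶜ))
              (comp sndᶜ (comp sndᶜ sndᶜ))))))

  state : ∀ bs ys acc → proj₂ (foldl step (ys , acc) bs) ≡ pick bs ys ʳ++ acc
  state []           ys       acc = refl
  state (b ∷ bs)     []       acc = trans (state bs [] acc) (cong (_ʳ++ acc) (pick-[] bs))
    where
    pick-[] : ∀ bs → pick bs [] ≡ []
    pick-[] []      = refl
    pick-[] (_ ∷ _) = refl
  state (true ∷ bs)  (y ∷ ys) acc = state bs ys (y ∷ acc)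
  state (false ∷ bs) (y ∷ ys) acc = state bs ys acc

  -- An entry is either moved to the accumulator or dropped, so the total space never grows.
  shrinks : ∀ s b → size (list A ⊗ list A) (step s b) ≤ size (list A ⊗ list A) s
  shrinks ([]       , acc) b     = ≤-refl
  shrinks (y ∷ rest , acc) true  =
    ≤-reflexive (eq (size A y) (size (list A) rest) (size (list A) acc))
    where
    eq : ∀ a b c → 1 + b + (1 + a + c) ≡ 1 + (1 + a + b) + c
    eq = solve-∀
  shrinks (y ∷ rest , acc) false = s≤s (+-monoˡ-≤ _ (m≤n+m _ (suc (size A y))))

  foldl-shrinks : ∀ s bs → size (list A ⊗ list A) (foldl step s bs) ≤ size (list A ⊗ list A) s
  foldl-shrinks s []       = ≤-refl
  foldl-shrinks s (b ∷ bs) = ≤-trans (foldl-shrinks (step s b) bs) (shrinks s b)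

  growth : ∀ x bs cs → f x ≡ bs ++ cs → size (list A ⊗ list A) (foldl step (g x , []) bs) ≤
    eval (const 1 ⊕ bound G ⊕ const 1) (size X x)
  growth x bs _ _ = ≤-trans (foldl-shrinks (g x , []) bs)
    (s≤s (+-monoˡ-≤ 1 (Halts.size≤ (halts G x))))

-- Arithmetic in polynomial time

infixl 6 _+ᶜ_ _∸ᶜ_
infixl 7 _*ᶜ_ _⊓ᶜ_

_+ᶜ_ : ∀ {f g} → Computable X nat f → Computable X nat g → Computable X nat (λ x → f x + g x)
F +ᶜ G = comp (pair F G) (opᶜ add)

_∸ᶜ_ : ∀ {f g} → Computable X nat f → Computable X nat g → Computable X nat (λ x → f x ∸ g x)
F ∸ᶜ G = comp (pair F G) (opᶜ monus)

_*ᶜ_ : ∀ {f g} → Computable X nat f → Computable X nat g → Computable X nat (λ x → f x * g x)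
F *ᶜ G = comp (pair F G) (opᶜ mul)

_⊓ᶜ_ : ∀ {f g} → Computable X nat f → Computable X nat g → Computable X nat (λ x → f x ⊓ g x)
_⊓ᶜ_ {f = f} {g} F G = computable-cong (λ x → m∸[m∸n]≡m⊓n (f x) (g x)) (F ∸ᶜ (F ∸ᶜ G))
  where
  m∸[m∸n]≡m⊓n : ∀ m n → m ∸ (m ∸ n) ≡ m ⊓ n
  m∸[m∸n]≡m⊓n m n with ≤-total m n
  ... | inj₁ m≤n = trans (cong (m ∸_) (m≤n⇒m∸n≡0 m≤n)) (sym (m≤n⇒m⊓n≡m m≤n))
  ... | inj₂ n≤m = trans (m∸[m∸n]≡n n≤m) (sym (m≥n⇒m⊓n≡n n≤m))

-- The reduction on encodings

fraction : Ty
fraction = nat ⊗ nat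

job : Ty
job = nat ⊗ fraction

edge : Ty
edge = (nat ⊗ nat) ⊗ fraction

-- Twice the weight of the edge between the first two of three jobs with
-- processing times x, y, z. The three edge weights are chosen such that
-- separating one job from the other two cuts min(x, y + z).
doubleWeight : ℕ → ℕ → ℕ → ℕ
doubleWeight x y z = x ⊓ (y + z) + y ⊓ (x + z) ∸ z ⊓ (x + y)

-- Cross-multiplication puts the three times over `α * (β * γ)`, so that minima are taken of natural
-- numbers. The 2 in the denominator undoes the doubling in `doubleWeight`.
weightFraction : (a b c : ℕ × ℕ) → ℕ × ℕ
weightFraction (a , α) (b , β) (c , γ) =
  doubleWeight (a * (β * γ)) (b * (α * γ)) (c * (α * β)) , 2 * (α * (β * γ))

-- The fraction `r` is the time of the job opposite the edge.
edgeBetween : ⟦ job ⟧ → ⟦ job ⟧ → ⟦ fraction ⟧ → ⟦ edge ⟧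
edgeBetween (u , p) (v , q) r = (u , v) , weightFraction p q r

scenarioEdges : List ⟦ job ⟧ → List ⟦ edge ⟧
-- Two jobs form a triangle whose third job has time 0, encoded as `(0 , 1)`.
scenarioEdges (i ∷ j ∷ [])     = edgeBetween i j (0 , 1) ∷ []
scenarioEdges (i ∷ j ∷ k ∷ []) =
  edgeBetween i j (proj₂ k) ∷ edgeBetween i k (proj₂ j) ∷ edgeBetween j k (proj₂ i) ∷ []
-- With fewer than two jobs the smaller load is 0 and nothing is to be cut. For more than three jobs
-- the empty list is a mere default.
scenarioEdges _                = []

edgeBetweenᶜ : ∀ {f g h} → Computable X job f → Computable X job g → Computable X fraction h →
  Computable X edge (λ x → edgeBetween (f x) (g x) (h x))
edgeBetweenᶜ {X} F G H = comp (pair F (pair G H)) (pair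
    (pair (comp fstᶜ fstᶜ) (comp sndᶜ (comp fstᶜ fstᶜ)))
    (pair ((x ⊓ᶜ (y +ᶜ z)) +ᶜ (y ⊓ᶜ (x +ᶜ z)) ∸ᶜ (z ⊓ᶜ (x +ᶜ y)))
          (litᶜ 2 *ᶜ (α *ᶜ (β *ᶜ γ)))))
  where
  Num : (⟦ job ⊗ (job ⊗ fraction) ⟧ → ℕ) → Set
  Num = Computable (job ⊗ (job ⊗ fraction)) nat
  a : Num (λ ((_ , p) , _ , _) → proj₁ p)
  a = comp fstᶜ (comp sndᶜ fstᶜ)
  α : Num (λ ((_ , p) , _ , _) → proj₂ p)
  α = comp fstᶜ (comp sndᶜ sndᶜ)
  b : Num (λ (_ , (_ , q) , _) → proj₁ q)
  b = comp sndᶜ (comp fstᶜ (comp sndᶜ fstᶜ))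
  β : Num (λ (_ , (_ , q) , _) → proj₂ q)
  β = comp sndᶜ (comp fstᶜ (comp sndᶜ sndᶜ))
  c : Num (λ (_ , _ , r) → proj₁ r)
  c = comp sndᶜ (comp sndᶜ fstᶜ)
  γ : Num (λ (_ , _ , r) → proj₂ r)
  γ = comp sndᶜ (comp sndᶜ sndᶜ)
  x = a *ᶜ (β *ᶜ γ)
  y = b *ᶜ (α *ᶜ γ)
  z = c *ᶜ (α *ᶜ β)

scenarioEdgesᶜ : ∀ {f} → Computable X (list job) f →
  Computable X (list edge) (λ x → scenarioEdges (f x))
scenarioEdgesᶜ F = comp {g = scenarioEdges} F (computable-cong (λ where
    []                  → refl
    (_ ∷ [])            → refl
    (_ ∷ _ ∷ [])        → refl
    (_ ∷ _ ∷ _ ∷ [])    → refl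
    (_ ∷ _ ∷ _ ∷ _ ∷ _) → refl)
  (case idᶜ (litᶜ []) (case (comp fstᶜ sndᶜ) (litᶜ []) (case (comp fstᶜ sndᶜ)
    (edgeBetweenᶜ (comp sndᶜ (comp fstᶜ fstᶜ)) (comp fstᶜ fstᶜ) (litᶜ (0 , 1)) ∷ᶜ litᶜ [])
    (case (comp fstᶜ sndᶜ)
      (edgeBetweenᶜ i j (comp k sndᶜ) ∷ᶜ edgeBetweenᶜ i k (comp j sndᶜ) ∷ᶜ
       edgeBetweenᶜ j k (comp i sndᶜ) ∷ᶜ litᶜ [])
      (litᶜ []))))))
  where
  case : ∀ {l f g} → Computable X (list A) l → Computable X B f →
    Computable ((A ⊗ list A) ⊗ X) B g →
    Computable X B (λ x → listCase f g (l x , x))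
  case L F G = comp (pair L idᶜ) (caseᶜ F G)
  -- Each `case` stacks a head and a tail on the environment, so `k`, `j` and `i` lie one level
  -- deeper in turn.
  k : Computable ((B ⊗ C) ⊗ X) B _
  k = comp fstᶜ fstᶜ
  j : Computable (X ⊗ ((B ⊗ C) ⊗ S)) B _
  j = comp sndᶜ k
  i : Computable (X ⊗ (A ⊗ ((B ⊗ C) ⊗ S))) B _
  i = comp sndᶜ j

reduction : ⟦ list fraction ⊗ list (list bool) ⟧ → ⟦ list nat ⊗ list edge ⟧
reduction (ps , scenarios) =
  map proj₁ jobs , concatMap (λ bs → scenarioEdges (pick bs jobs)) scenarios
  where
  jobs : List ⟦ job ⟧
  jobs = enumFrom 0 ps

-- Abstract, lest unification unfold the program.
abstract
  reductionᶜ : Computable (list fraction ⊗ list (list bool)) (list nat ⊗ list edge) reduction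
  reductionᶜ = pair (mapᶜ jobs (comp fstᶜ fstᶜ))
    (concatMapᶜ sndᶜ (scenarioEdgesᶜ (pickᶜ fstᶜ (comp sndᶜ jobs))))
    where
    jobs : Computable (list fraction ⊗ list (list bool)) (list job) (λ (ps , _) → enumFrom 0 ps)
    jobs = enumᶜ fstᶜ

-- Cuts of the triangle on three jobs

doubleWeight-comm : ∀ x y z → doubleWeight x y z ≡ doubleWeight y x z
doubleWeight-comm x y z = cong₂ _∸_ (+-comm (x ⊓ (y + z)) (y ⊓ (x + z))) (cong (z ⊓_) (+-comm x y))

-- If a minimum on the right is attained by its sum, that sum already contains `y`; otherwise the
-- right side is `x + z`. The inequality makes the truncated subtraction in `doubleWeight` exact.
⊓-triangle : ∀ x y z → y ⊓ (x + z) ≤ x ⊓ (y + z) + z ⊓ (x + y)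
⊓-triangle x y z with ⊓-sel x (y + z) | ⊓-sel z (x + y)
... | inj₂ eq | _       = ≤-trans (m⊓n≤m y (x + z))
  (m≤n⇒m≤n+o _ (≤-trans (m≤m+n y z) (≤-reflexive (sym eq))))
... | inj₁ _  | inj₂ eq = ≤-trans (m⊓n≤m y (x + z))
  (m≤n⇒m≤o+n (x ⊓ (y + z)) (≤-trans (m≤n+m y x) (≤-reflexive (sym eq))))
... | inj₁ eq | inj₁ eq′ = ≤-trans (m⊓n≤n y (x + z))
  (≤-reflexive (sym (cong₂ _+_ eq eq′)))

-- The two edges at the first job carry `m + n - o` and `m + o - n`, so `n` and `o` cancel. Adding
-- `o + n` to both sides avoids reasoning with truncated subtraction.
doubleWeight-star : ∀ x y z → doubleWeight x y z + doubleWeight x z y ≡ 2 * (x ⊓ (y + z))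
doubleWeight-star x y z = begin
  doubleWeight x y z + doubleWeight x z y
    ≡⟨ cong (λ s → doubleWeight x y z + (x ⊓ s + z ⊓ (x + y) ∸ y ⊓ (x + z))) (+-comm z y) ⟩
  (m + n ∸ o) + (m + o ∸ n)               ≡⟨ +-cancelʳ-≡ (o + n) _ _ (begin
    (m + n ∸ o) + (m + o ∸ n) + (o + n)      ≡⟨ regroup (m + n ∸ o) (m + o ∸ n) o n ⟩
    (m + n ∸ o + o) + (m + o ∸ n + n)        ≡⟨ cong₂ _+_ (m∸n+n≡m o≤m+n) (m∸n+n≡m n≤m+o) ⟩
    (m + n) + (m + o)                        ≡⟨ collect m n o ⟩
    2 * m + (o + n)                          ∎) ⟩
  2 * m                                   ∎
  where
  open ≡-Reasoning
  m n o : ℕ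
  m = x ⊓ (y + z)
  n = y ⊓ (x + z)
  o = z ⊓ (x + y)
  n≤m+o : n ≤ m + o
  n≤m+o = ⊓-triangle x y z
  o≤m+n : o ≤ m + n
  o≤m+n = ≤-trans (⊓-triangle x z y) (≤-reflexive (cong (λ s → x ⊓ s + n) (+-comm z y)))
  regroup : ∀ a b c d → a + b + (c + d) ≡ (a + c) + (b + d)
  regroup = solve-∀
  collect : ∀ a b c → (a + b) + (a + c) ≡ 2 * a + (c + b)
  collect = solve-∀

keep : Bool → ℕ → ℕ
keep b n = if b then n else 0

-- The sums have the form to which both sides of `cut-triangle` compute once the Booleans are known,
-- the entries dropped by `keep` vanishing.
separate : ∀ x y z → 2 * (x ⊓ (y + z)) ≡ sum (2 * x ∷ []) ⊓ sum (2 * y ∷ 2 * z ∷ [])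
separate x y z = trans (*-distribˡ-⊓ 2 x (y + z))
  (cong₂ _⊓_ (sym (+-identityʳ (2 * x))) (distrib y z))
  where
  distrib : ∀ y z → 2 * (y + z) ≡ 2 * y + (2 * z + 0)
  distrib = solve-∀

separate-first : ∀ x y z → sum (doubleWeight x y z ∷ doubleWeight x z y ∷ []) ≡
  sum (2 * x ∷ []) ⊓ sum (2 * y ∷ 2 * z ∷ [])
separate-first x y z = trans (cong (doubleWeight x y z +_) (+-identityʳ _))
  (trans (doubleWeight-star x y z) (separate x y z))

separate-second : ∀ x y z → sum (doubleWeight x y z ∷ doubleWeight y z x ∷ []) ≡
  sum (2 * y ∷ []) ⊓ sum (2 * x ∷ 2 * z ∷ [])
separate-second x y z =
  trans (cong (_+ (doubleWeight y z x + 0)) (doubleWeight-comm x y z)) (separate-first y x z)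

separate-third : ∀ x y z → sum (doubleWeight x z y ∷ doubleWeight y z x ∷ []) ≡
  sum (2 * z ∷ []) ⊓ sum (2 * x ∷ 2 * y ∷ [])
separate-third x y z =
  trans (cong₂ (λ u v → u + (v + 0)) (doubleWeight-comm x z y) (doubleWeight-comm y z x))
        (separate-first z x y)

-- Either all three jobs share a machine and both sides are 0, or exactly one job is separated from
-- the other two. Exchanging the machines only swaps the arguments of the minimum.
cut-triangle : ∀ a b c x y z →
  sum (keep (a xor b) (doubleWeight x y z) ∷ keep (a xor c) (doubleWeight x z y) ∷
       keep (b xor c) (doubleWeight y z x) ∷ [])
  ≡ sum (keep a (2 * x) ∷ keep b (2 * y) ∷ keep c (2 * z) ∷ [])
  ⊓ sum (keep (not a) (2 * x) ∷ keep (not b) (2 * y) ∷ keep (not c) (2 * z) ∷ [])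
cut-triangle true  true  true  x y z = sym (⊓-zeroʳ _)
cut-triangle false false false x y z = refl
cut-triangle true  false false x y z = separate-first x y z
cut-triangle false true  true  x y z = trans (separate-first x y z) (⊓-comm (sum (2 * x ∷ [])) _)
cut-triangle false true  false x y z = separate-second x y z
cut-triangle true  false true  x y z = trans (separate-second x y z) (⊓-comm (sum (2 * y ∷ [])) _)
cut-triangle false false true  x y z = separate-third x y z
cut-triangle true  true  false x y z = trans (separate-third x y z) (⊓-comm (sum (2 * z ∷ [])) _)

-- With third time 0 the subtracted term is 0, and the two remaining minima coincide.
separate-pair : ∀ x y → sum (doubleWeight x y 0 ∷ []) ≡ sum (2 * x ∷ []) ⊓ sum (2 * y ∷ [])
separate-pair x y = begin
  x ⊓ (y + 0) + y ⊓ (x + 0) + 0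
    ≡⟨ cong₂ (λ u v → x ⊓ u + y ⊓ v + 0) (+-identityʳ y) (+-identityʳ x) ⟩
  x ⊓ y + y ⊓ x + 0               ≡⟨ cong (λ u → x ⊓ y + u + 0) (⊓-comm y x) ⟩
  x ⊓ y + x ⊓ y + 0               ≡⟨ +-assoc (x ⊓ y) _ 0 ⟩
  2 * (x ⊓ y)                     ≡⟨ *-distribˡ-⊓ 2 x y ⟩
  (2 * x) ⊓ (2 * y)
    ≡⟨ cong₂ _⊓_ (sym (+-identityʳ (2 * x))) (sym (+-identityʳ (2 * y))) ⟩
  (2 * x + 0) ⊓ (2 * y + 0)       ∎
  where open ≡-Reasoning

cut-pair : ∀ a b x y →
  sum (keep (a xor b) (doubleWeight x y 0) ∷ [])
  ≡ sum (keep a (2 * x) ∷ keep b (2 * y) ∷ [])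
  ⊓ sum (keep (not a) (2 * x) ∷ keep (not b) (2 * y) ∷ [])
cut-pair true  true  x y = sym (⊓-zeroʳ _)
cut-pair false false x y = refl
cut-pair true  false x y = separate-pair x y
cut-pair false true  x y = trans (separate-pair x y) (⊓-comm (sum (2 * x ∷ [])) _)

-- Fractions over a common denominator

frac : ℕ → (d : ℕ) .{{_ : NonZero d}} → ℚᵘ
frac n d = ℤ.+ n ℚᵘ./ d

frac-≃ : ∀ {m n c d} .{{_ : NonZero c}} .{{_ : NonZero d}} → m * d ≡ n * c → frac m c ≃ frac n d
frac-≃ {m} {n} {c@(suc _)} {d@(suc _)} eq =
  *≡* (trans (sym (ℤ.pos-* m d)) (trans (cong ℤ.+_ eq) (ℤ.pos-* n c)))

frac-mono : ∀ {m n} d .{{_ : NonZero d}} → m ≤ n → frac m d ℚᵘ.≤ frac n d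
frac-mono {m} {n} d@(suc _) m≤n = *≤* (ℤ.*-monoʳ-≤-nonNeg (ℤ.+ d) (ℤ.+≤+ m≤n))

frac-⊓ : ∀ m n d .{{_ : NonZero d}} → frac m d ℚᵘ.⊓ frac n d ≃ frac (m ⊓ n) d
frac-⊓ m n d with ≤-total m n
... | inj₁ m≤n = ℚᵘ.≃-trans (ℚᵘ.p≤q⇒p⊓q≃p (frac-mono d m≤n))
  (ℚᵘ.≃-reflexive (cong (λ k → frac k d) (sym (m≤n⇒m⊓n≡m m≤n))))
... | inj₂ n≤m = ℚᵘ.≃-trans (ℚᵘ.p≥q⇒p⊓q≃q (frac-mono d n≤m))
  (ℚᵘ.≃-reflexive (cong (λ k → frac k d) (sym (m≥n⇒m⊓n≡n n≤m))))

frac-+ : ∀ m n d .{{_ : NonZero d}} → frac m d ℚᵘ.+ frac n d ≃ frac (m + n) d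
frac-+ m n d@(suc _) = *≡* (begin
  (ℤ.+ m ℤ.* ℤ.+ d ℤ.+ ℤ.+ n ℤ.* ℤ.+ d) ℤ.* ℤ.+ d ≡⟨ factor (ℤ.+ m) (ℤ.+ n) (ℤ.+ d) ⟩
  (ℤ.+ m ℤ.+ ℤ.+ n) ℤ.* (ℤ.+ d ℤ.* ℤ.+ d)
    ≡⟨ cong₂ ℤ._*_ (sym (ℤ.pos-+ m n)) (sym (ℤ.pos-* d d)) ⟩
  ℤ.+ (m + n) ℤ.* ℤ.+ (d * d)                     ∎)
  where
  open ≡-Reasoning
  factor : ∀ m n d → (m ℤ.* d ℤ.+ n ℤ.* d) ℤ.* d ≡ (m ℤ.+ n) ℤ.* (d ℤ.* d)
  factor = ℤ-RingSolver.solve-∀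

infix 4 _≈_over_

_≈_over_ : List ℚᵘ → List ℕ → (d : ℕ) .{{_ : NonZero d}} → Set
qs ≈ ns over d = Pointwise (λ q n → q ≃ frac n d) qs ns

sumList-frac : ∀ {qs ns} d .{{_ : NonZero d}} → qs ≈ ns over d → sumList qs ≃ frac (sum ns) d
sumList-frac d []       = frac-≃ {0} {0} {1} {d} refl
sumList-frac d (_∷_ {y = n} q≃ qs≃) =
  ℚᵘ.≃-trans (ℚᵘ.+-cong q≃ (sumList-frac d qs≃)) (frac-+ n _ d)

keep-frac : ∀ b {q n} d .{{_ : NonZero d}} → q ≃ frac n d →
  (if b then q else 0ℚᵘ) ≃ frac (keep b n) d
keep-frac true  d q≃ = q≃
keep-frac false d q≃ = frac-≃ {0} {0} {1} {d} refl

-- Over one denominator, sums and minima act on numerators alone, so the cut identities for natural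
-- numbers carry over to rationals.
sumList-⊓ : ∀ {qs ls rs ms ns os} d .{{_ : NonZero d}} →
  qs ≈ ms over d → ls ≈ ns over d → rs ≈ os over d →
  sum ms ≡ sum ns ⊓ sum os → sumList qs ≃ sumList ls ℚᵘ.⊓ sumList rs
sumList-⊓ {qs} {ls} {rs} {ms} {ns} {os} d qs≃ ls≃ rs≃ eq = begin
  sumList qs                           ≈⟨ sumList-frac d qs≃ ⟩
  frac (sum ms) d                      ≡⟨ cong (λ k → frac k d) eq ⟩
  frac (sum ns ⊓ sum os) d             ≈⟨ ℚᵘ.≃-sym (frac-⊓ (sum ns) (sum os) d) ⟩
  frac (sum ns) d ℚᵘ.⊓ frac (sum os) d
    ≈⟨ ℚᵘ.⊓-cong (ℚᵘ.≃-sym (sumList-frac d ls≃)) (ℚᵘ.≃-sym (sumList-frac d rs≃)) ⟩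
  sumList ls ℚᵘ.⊓ sumList rs           ∎
  where open ℚᵘ.≃-Reasoning

nonNegative-frac : ∀ {q} → 0ℚᵘ ℚᵘ.≤ q → q ≡ frac ℤ.∣ ↥ q ∣ (↧ₙ q)
nonNegative-frac {mkℚᵘ n d} 0≤q = cong (λ n → mkℚᵘ n d) (sym (ℤ.0≤i⇒+∣i∣≡i (ℚᵘ.≥0⇒↥≥0 {n} {d} 0≤q)))

-- Scenarios as lists of jobs

members : ∀ {n} → Subset n → List (Fin n)
members []          = []
members (true ∷ S)  = zero ∷ map suc (members S)
members (false ∷ S) = map suc (members S)

length-members : ∀ {n} (S : Subset n) → length (members S) ≡ ∣ S ∣
length-members []          = refl
length-members (true ∷ S)  = cong suc (trans (List.length-map suc (members S)) (length-members S))
length-members (false ∷ S) = trans (List.length-map suc (members S)) (length-members S)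

members-unique : ∀ {n} (S : Subset n) → Unique (members S)
members-unique []          = []
members-unique (true ∷ S)  =
  All.map⁺ (universal (λ _ ()) (members S)) ∷ Unique.map⁺ Fin.suc-injective (members-unique S)
members-unique (false ∷ S) = Unique.map⁺ Fin.suc-injective (members-unique S)

pick-members : ∀ {n} {Y : Set} (S : Subset n) (f : Fin n → Y) →
  pick (Vec.toList S) (tabulate f) ≡ map f (members S)
pick-members []          f = refl
pick-members (true ∷ S)  f = cong (f zero ∷_) (trans (pick-members S (f ∘ suc)) (List.map-∘ (members S)))
pick-members (false ∷ S) f = trans (pick-members S (f ∘ suc)) (List.map-∘ (members S))

enumFrom-tabulate : ∀ {n} {Y : Set} k (f : Fin n → Y) →
  enumFrom k (tabulate f) ≡ tabulate (λ j → k + toℕ j , f j)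
enumFrom-tabulate {zero}  k f = refl
enumFrom-tabulate {suc n} k f = cong₂ _∷_ (cong (_, f zero) (sym (+-identityʳ k)))
  (trans (enumFrom-tabulate (suc k) (f ∘ suc))
         (List.tabulate-cong λ j → cong (_, f (suc j)) (sym (+-suc k (toℕ j)))))

-- Edge weights over the common denominator

numerator : (q r s : ℚᵘ) → ℕ
numerator q r s = ℤ.∣ ↥ q ∣ * (↧ₙ r * ↧ₙ s)

commonDenominator : (q r s : ℚᵘ) → ℕ
commonDenominator q r s = 2 * (↧ₙ q * (↧ₙ r * ↧ₙ s))

-- Definitionally the value of weightFraction on the encodings.
edgeWeight : (q r s : ℚᵘ) → ℚᵘ
edgeWeight q r s =
  frac (doubleWeight (numerator q r s) (numerator r q s) (numerator s q r)) (commonDenominator q r s)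

first-frac : ∀ {q} r s → 0ℚᵘ ℚᵘ.≤ q → q ≃ frac (2 * numerator q r s) (commonDenominator q r s)
first-frac {q} r s q≥0 = ℚᵘ.≃-trans (ℚᵘ.≃-reflexive (nonNegative-frac q≥0))
  (frac-≃ (eq ℤ.∣ ↥ q ∣ (↧ₙ q) (↧ₙ r) (↧ₙ s)))
  where
  eq : ∀ a α β γ → a * (2 * (α * (β * γ))) ≡ 2 * (a * (β * γ)) * α
  eq = solve-∀

second-frac : ∀ {r} q s → 0ℚᵘ ℚᵘ.≤ r → r ≃ frac (2 * numerator r q s) (commonDenominator q r s)
second-frac {r} q s r≥0 = ℚᵘ.≃-trans (ℚᵘ.≃-reflexive (nonNegative-frac r≥0))
  (frac-≃ (eq ℤ.∣ ↥ r ∣ (↧ₙ q) (↧ₙ r) (↧ₙ s)))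
  where
  eq : ∀ b α β γ → b * (2 * (α * (β * γ))) ≡ 2 * (b * (α * γ)) * β
  eq = solve-∀

third-frac : ∀ {s} q r → 0ℚᵘ ℚᵘ.≤ s → s ≃ frac (2 * numerator s q r) (commonDenominator q r s)
third-frac {s} q r s≥0 = ℚᵘ.≃-trans (ℚᵘ.≃-reflexive (nonNegative-frac s≥0))
  (frac-≃ (eq ℤ.∣ ↥ s ∣ (↧ₙ q) (↧ₙ r) (↧ₙ s)))
  where
  eq : ∀ c α β γ → c * (2 * (α * (β * γ))) ≡ 2 * (c * (α * β)) * γ
  eq = solve-∀

numerator-comm : ∀ q r s → numerator q r s ≡ numerator q s r
numerator-comm q r s = cong (ℤ.∣ ↥ q ∣ *_) (*-comm (↧ₙ r) (↧ₙ s))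

-- Every edge lists the three times in its own order. Commuting factors gives all edges of a
-- triangle the numerators and denominator of the first.
edgeWeight-swap : ∀ q r s → edgeWeight q s r ≃
  frac (doubleWeight (numerator q r s) (numerator s q r) (numerator r q s)) (commonDenominator q r s)
edgeWeight-swap q r s = ℚᵘ.≃-reflexive (ℚᵘ./-cong
  (cong (λ x → ℤ.+ doubleWeight x (numerator s q r) (numerator r q s)) (numerator-comm q s r))
  (cong (λ d → 2 * (↧ₙ q * d)) (*-comm (↧ₙ s) (↧ₙ r))))

edgeWeight-rotate : ∀ q r s → edgeWeight r s q ≃
  frac (doubleWeight (numerator r q s) (numerator s q r) (numerator q r s)) (commonDenominator q r s)
edgeWeight-rotate q r s = ℚᵘ.≃-reflexive (ℚᵘ./-cong
  (cong₂ (λ y z → ℤ.+ doubleWeight y z (numerator q r s))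
         (numerator-comm r s q) (numerator-comm s r q))
  (eq (↧ₙ q) (↧ₙ r) (↧ₙ s)))
  where
  eq : ∀ α β γ → 2 * (β * (γ * α)) ≡ 2 * (α * (β * γ))
  eq = solve-∀

-- Cuts in the graph of one scenario

module Reduction (n : ℕ) (p : Fin n → ℚᵘ) (p≥0 : ∀ j → 0ℚᵘ ℚᵘ.≤ p j) where

  jobEdge : (i j : Fin n) → i ≢ j → ℚᵘ → Edge n
  jobEdge i j i≢j s = record
    { u        = i
    ; v        = j
    ; u≢v      = i≢j
    ; weight   = edgeWeight (p i) (p j) s
    ; weight≥0 = ℚᵘ.≤-trans (ℚᵘ.≤-reflexive (frac-≃ {0} {0} {1} refl)) (frac-mono _ z≤n)
    }

  -- Mirrors `scenarioEdges` on genuine edges: uniqueness of the jobs excludes loops, and `0ℚᵘ`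
  -- encodes as `(0 , 1)`.
  jobEdges : (js : List (Fin n)) → Unique js → List (Edge n)
  jobEdges (i ∷ j ∷ []) ((i≢j ∷ []) ∷ _) = jobEdge i j i≢j 0ℚᵘ ∷ []
  jobEdges (i ∷ j ∷ k ∷ []) ((i≢j ∷ i≢k ∷ []) ∷ (j≢k ∷ []) ∷ _) =
    jobEdge i j i≢j (p k) ∷ jobEdge i k i≢k (p j) ∷ jobEdge j k j≢k (p i) ∷ []
  jobEdges _ _ = []

  subsetEdges : Subset n → List (Edge n)
  subsetEdges S = jobEdges (members S) (members-unique S)

  encodeJob : Fin n → ⟦ job ⟧
  encodeJob j = toℕ j , encodeℚ⁺ (p j)

  -- Fractions are never reduced to lowest terms, so an encoded weight computes to exactly the pair
  -- produced by the program.
  scenarioEdges-encode : ∀ js (js! : Unique js) →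
    scenarioEdges (map encodeJob js) ≡ map encodeEdge (jobEdges js js!)
  scenarioEdges-encode []                  _ = refl
  scenarioEdges-encode (_ ∷ [])            _ = refl
  scenarioEdges-encode (_ ∷ _ ∷ [])        ((_ ∷ []) ∷ _) = refl
  scenarioEdges-encode (_ ∷ _ ∷ _ ∷ [])    ((_ ∷ _ ∷ []) ∷ (_ ∷ []) ∷ _) = refl
  scenarioEdges-encode (_ ∷ _ ∷ _ ∷ _ ∷ _) _ = refl

  portion : Subset n → List (Fin n) → ℚᵘ
  portion A js = sumList (map (λ j → if lookup A j then p j else 0ℚᵘ) js)

  -- Together with `cut`, restates `Graph.cutWeight` for an arbitrary list of edges, so that a cut
  -- can be split by scenario.
  contribution : Subset n → Edge n → ℚᵘ
  contribution A e = if lookup A u xor lookup A v then weight else 0ℚᵘ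
    where open Edge e

  cut : Subset n → List (Edge n) → ℚᵘ
  cut A es = sumList (map (contribution A) es)

  -- A bit of `∁ A` is the negated bit of `A`; after rewriting with this, `cut-pair` and
  -- `cut-triangle` apply over the common denominator. A single job leaves one machine empty.
  jobEdges-cut : ∀ A js (js! : Unique js) → length js ≤ 3 →
    cut A (jobEdges js js!) ≃ portion A js ℚᵘ.⊓ portion (∁ A) js
  jobEdges-cut A [] _ _ = ℚᵘ.≃-sym (ℚᵘ.⊓-idem 0ℚᵘ)
  jobEdges-cut A (i ∷ []) _ _
    rewrite Vec.lookup-map i not A = sumList-⊓ (↧ₙ (p i)) []
      (keep-frac a _ p≃ ∷ []) (keep-frac (not a) _ p≃ ∷ []) (alone a)
    where
    a : Bool
    a = lookup A i
    x : ℕ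
    x = ℤ.∣ ↥ p i ∣
    p≃ : p i ≃ frac x (↧ₙ (p i))
    p≃ = ℚᵘ.≃-reflexive (nonNegative-frac (p≥0 i))
    alone : ∀ a → 0 ≡ sum (keep a x ∷ []) ⊓ sum (keep (not a) x ∷ [])
    alone true  = sym (⊓-zeroʳ _)
    alone false = refl
  jobEdges-cut A (i ∷ j ∷ []) ((_ ∷ []) ∷ _) _
    rewrite Vec.lookup-map i not A | Vec.lookup-map j not A =
      sumList-⊓ (commonDenominator (p i) (p j) 0ℚᵘ)
      (keep-frac (a xor b) _ ℚᵘ.≃-refl ∷ [])
      (keep-frac a _ pi≃ ∷ keep-frac b _ pj≃ ∷ [])
      (keep-frac (not a) _ pi≃ ∷ keep-frac (not b) _ pj≃ ∷ [])
      (cut-pair a b (numerator (p i) (p j) 0ℚᵘ) (numerator (p j) (p i) 0ℚᵘ))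
    where
    a b : Bool
    a = lookup A i
    b = lookup A j
    pi≃ = first-frac (p j) 0ℚᵘ (p≥0 i)
    pj≃ = second-frac (p i) 0ℚᵘ (p≥0 j)
  jobEdges-cut A (i ∷ j ∷ k ∷ []) ((_ ∷ _ ∷ []) ∷ (_ ∷ []) ∷ _) _
    rewrite Vec.lookup-map i not A | Vec.lookup-map j not A | Vec.lookup-map k not A =
      sumList-⊓ (commonDenominator (p i) (p j) (p k))
      (keep-frac (a xor b) _ ℚᵘ.≃-refl ∷ keep-frac (a xor c) _ edge-ik ∷
       keep-frac (b xor c) _ edge-jk ∷ [])
      (keep-frac a _ pi≃ ∷ keep-frac b _ pj≃ ∷ keep-frac c _ pk≃ ∷ [])
      (keep-frac (not a) _ pi≃ ∷ keep-frac (not b) _ pj≃ ∷ keep-frac (not c) _ pk≃ ∷ [])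
      (cut-triangle a b c (numerator (p i) (p j) (p k))
        (numerator (p j) (p i) (p k)) (numerator (p k) (p i) (p j)))
    where
    a b c : Bool
    a = lookup A i
    b = lookup A j
    c = lookup A k
    pi≃ = first-frac (p j) (p k) (p≥0 i)
    pj≃ = second-frac (p i) (p k) (p≥0 j)
    pk≃ = third-frac (p i) (p j) (p≥0 k)
    edge-ik = edgeWeight-swap (p i) (p j) (p k)
    edge-jk = edgeWeight-rotate (p i) (p j) (p k)
  jobEdges-cut A (_ ∷ _ ∷ _ ∷ _ ∷ _) _ (s≤s (s≤s (s≤s ())))

  portion-complement : ∀ A js → portion A js ℚᵘ.+ portion (∁ A) js ≃ sumList (map p js)
  portion-complement A []       = ℚᵘ.+-identityˡ 0ℚᵘ
  portion-complement A (j ∷ js) rewrite Vec.lookup-map j not A = ℚᵘ.≃-trans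
    (interchange ℚᵘ-+-commutativeSemigroup (here (lookup A j)) (portion A js)
      (here (not (lookup A j))) (portion (∁ A) js))
    (ℚᵘ.+-cong (both (lookup A j)) (portion-complement A js))
    where
    here : Bool → ℚᵘ
    here b = if b then p j else 0ℚᵘ
    both : ∀ b → here b ℚᵘ.+ here (not b) ≃ p j
    both true  = ℚᵘ.+-identityʳ (p j)
    both false = ℚᵘ.+-identityˡ (p j)

  cut-++ : ∀ A es fs → cut A (es ++ fs) ≃ cut A es ℚᵘ.+ cut A fs
  cut-++ A []       fs = ℚᵘ.≃-sym (ℚᵘ.+-identityˡ _)
  cut-++ A (e ∷ es) fs = ℚᵘ.≃-trans (ℚᵘ.+-congʳ (contribution A e) (cut-++ A es fs))
    (ℚᵘ.≃-sym (ℚᵘ.+-assoc (contribution A e) (cut A es) (cut A fs)))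

-- Makespans against cuts, summed over all scenarios

sum-members : ∀ {n} (A S : Subset n) (p : Fin n → ℚᵘ) →
  sumFin (λ j → if lookup (A ∩ S) j then p j else 0ℚᵘ)
  ≃ sumList (map (λ j → if lookup A j then p j else 0ℚᵘ) (members S))
sum-members []      []          p = ℚᵘ.≃-refl
sum-members (a ∷ A) (true ∷ S)  p = ℚᵘ.+-cong (head a)
  (ℚᵘ.≃-trans (sum-members A S (p ∘ suc)) (ℚᵘ.≃-reflexive (cong sumList (List.map-∘ (members S)))))
  where
  head : ∀ a → (if lookup ((a ∷ A) ∩ (true ∷ S)) zero then p zero else 0ℚᵘ) ≃
    (if a then p zero else 0ℚᵘ)
  head true  = ℚᵘ.≃-refl
  head false = ℚᵘ.≃-refl
sum-members (a ∷ A) (false ∷ S) p = ℚᵘ.≃-trans (ℚᵘ.+-cong (head a) (sum-members A S (p ∘ suc)))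
  (ℚᵘ.≃-trans (ℚᵘ.+-identityˡ _) (ℚᵘ.≃-reflexive (cong sumList (List.map-∘ (members S)))))
  where
  head : ∀ a → (if lookup ((a ∷ A) ∩ (false ∷ S)) zero then p zero else 0ℚᵘ) ≃ 0ℚᵘ
  head true  = ℚᵘ.≃-refl
  head false = ℚᵘ.≃-refl

module _ (I : SM2Instance) where
  open SM2Instance I
  open Reduction n p p≥0

  graph : Graph
  graph = record { n = n ; edges = concatMap subsetEdges scenarios }

  -- A Max Cut algorithm is specified only on encodings of graphs, so the output of the reduction
  -- has to be one.
  reduction-encode : reduction (OptProblem.encode SM2 I) ≡ OptProblem.encode MaxCut graph
  reduction-encode = cong₂ _,_
    (trans (cong (map proj₁) jobs≡) (List.map-tabulate encodeJob proj₁))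
    (begin
      concatMap (λ bs → scenarioEdges (pick bs jobs)) (map Vec.toList scenarios)
        ≡⟨ List.concatMap-map _ Vec.toList scenarios ⟩
      concatMap (λ S → scenarioEdges (pick (Vec.toList S) jobs)) scenarios
        ≡⟨ List.concatMap-cong edges≡ scenarios ⟩
      concatMap (map encodeEdge ∘ subsetEdges) scenarios
        ≡⟨ sym (List.map-concatMap encodeEdge subsetEdges scenarios) ⟩
      map encodeEdge (concatMap subsetEdges scenarios) ∎)
    where
    open ≡-Reasoning
    jobs : List ⟦ job ⟧
    jobs = enumFrom 0 (tabulate (encodeℚ⁺ ∘ p))
    jobs≡ : jobs ≡ tabulate encodeJob
    jobs≡ = enumFrom-tabulate 0 (encodeℚ⁺ ∘ p)
    edges≡ : ∀ S → scenarioEdges (pick (Vec.toList S) jobs) ≡ map encodeEdge (subsetEdges S)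
    edges≡ S = trans
      (cong scenarioEdges (trans (cong (pick (Vec.toList S)) jobs≡) (pick-members S encodeJob)))
      (scenarioEdges-encode (members S) (members-unique S))

  module _ (A S : Subset n) (|S|≤3 : ∣ S ∣ ≤ 3) where

    private
      l r : ℚᵘ
      l = portion A (members S)
      r = portion (∁ A) (members S)

      makespan≃ : makespan A S ≃ l ℚᵘ.⊔ r
      makespan≃ = ℚᵘ.⊔-cong (sum-members A S p) (sum-members (∁ A) S p)

      cut≃ : cut A (subsetEdges S) ≃ l ℚᵘ.⊓ r
      cut≃ = jobEdges-cut A (members S) (members-unique S)
        (≤-trans (≤-reflexive (length-members S)) |S|≤3)

    cut≤makespan : cut A (subsetEdges S) ℚᵘ.≤ makespan A S
    cut≤makespan = ℚᵘ.≤-respˡ-≃ (ℚᵘ.≃-sym cut≃) (ℚᵘ.≤-respʳ-≃ (ℚᵘ.≃-sym makespan≃) (ℚᵘ.p⊓q≤p⊔q l r))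

    -- The maximum and the minimum of the two loads add up to both loads, that is, to the time of
    -- all jobs of the scenario.
    makespan+cut : makespan A S ℚᵘ.+ cut A (subsetEdges S) ≃ sumList (map p (members S))
    makespan+cut = ℚᵘ.≃-trans (ℚᵘ.+-cong makespan≃ cut≃)
      (ℚᵘ.≃-trans max+min (portion-complement A (members S)))
      where
      max+min : l ℚᵘ.⊔ r ℚᵘ.+ l ℚᵘ.⊓ r ≃ l ℚᵘ.+ r
      max+min with ℚᵘ.≤-total l r
      ... | inj₁ l≤r = ℚᵘ.≃-trans (ℚᵘ.+-cong (ℚᵘ.p≤q⇒p⊔q≃q l≤r) (ℚᵘ.p≤q⇒p⊓q≃p l≤r)) (ℚᵘ.+-comm r l)
      ... | inj₂ r≤l = ℚᵘ.+-cong (ℚᵘ.p≥q⇒p⊔q≃p r≤l) (ℚᵘ.p≥q⇒p⊓q≃q r≤l)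

  processing : ℚᵘ
  processing = sumList (map (λ S → sumList (map p (members S))) scenarios)

  -- The right side is independent of `A`: a partition is better for one problem exactly when it is
  -- better for the other.
  total+cut : AtMostThreeJobs I → ∀ A → totalMakespan A ℚᵘ.+ Graph.cutWeight graph A ≃ processing
  total+cut small A = go scenarios small
    where
    go : ∀ Ss → All (λ S → ∣ S ∣ ≤ 3) Ss →
      sumList (map (makespan A) Ss) ℚᵘ.+ cut A (concatMap subsetEdges Ss) ≃
      sumList (map (λ S → sumList (map p (members S))) Ss)
    go []       []             = ℚᵘ.+-identityˡ 0ℚᵘ
    go (S ∷ Ss) (|S|≤3 ∷ small) = begin
      makespan A S ℚᵘ.+ rest ℚᵘ.+ cut A (subsetEdges S ++ concatMap subsetEdges Ss)
        ≈⟨ ℚᵘ.+-congʳ (makespan A S ℚᵘ.+ rest)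
             (cut-++ A (subsetEdges S) (concatMap subsetEdges Ss)) ⟩
      makespan A S ℚᵘ.+ rest ℚᵘ.+ (cut A (subsetEdges S) ℚᵘ.+ cut A (concatMap subsetEdges Ss))
        ≈⟨ interchange ℚᵘ-+-commutativeSemigroup (makespan A S) rest
             (cut A (subsetEdges S)) (cut A (concatMap subsetEdges Ss)) ⟩
      makespan A S ℚᵘ.+ cut A (subsetEdges S) ℚᵘ.+ (rest ℚᵘ.+ cut A (concatMap subsetEdges Ss))
        ≈⟨ ℚᵘ.+-cong (makespan+cut A S |S|≤3) (go Ss small) ⟩
      sumList (map (λ S → sumList (map p (members S))) (S ∷ Ss)) ∎
      where
      open ℚᵘ.≃-Reasoning
      rest : ℚᵘ
      rest = sumList (map (makespan A) Ss)

  -- Allows an error relative to the best cut to be charged to the optimal sum of makespans.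
  cut≤total : AtMostThreeJobs I → ∀ A → Graph.cutWeight graph A ℚᵘ.≤ totalMakespan A
  cut≤total small A = go scenarios small
    where
    go : ∀ Ss → All (λ S → ∣ S ∣ ≤ 3) Ss →
      cut A (concatMap subsetEdges Ss) ℚᵘ.≤ sumList (map (makespan A) Ss)
    go []       []             = ℚᵘ.≤-refl
    go (S ∷ Ss) (|S|≤3 ∷ small) = ℚᵘ.≤-respˡ-≃
      (ℚᵘ.≃-sym (cut-++ A (subsetEdges S) (concatMap subsetEdges Ss)))
      (ℚᵘ.+-mono-≤ (cut≤makespan A S |S|≤3) (go Ss small))

-- Transfer of the approximation ratio

Upper-resp-≃ : ∀ ρ {q r} → q ≃ r → ℝ.Upper ρ q → ℝ.Upper ρ r
Upper-resp-≃ ρ {q} {r} q≃r u =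
  let s , s<q , us = Equivalence.to (ℝ.upper-rounded ρ q) u
  in Equivalence.from (ℝ.upper-rounded ρ r) (s , ℚᵘ.<-respʳ-≃ q≃r s<q , us)

-- A cut within (1 - e) of the best one loses at most e times the best cut,
-- and this is at most e times the optimal makespan sum.
approximate-total : ∀ {v k o k* P e} → v ℚᵘ.+ k ≃ P → o ℚᵘ.+ k* ≃ P → 0ℚᵘ ℚᵘ.≤ e → k* ℚᵘ.≤ o →
  (1ℚᵘ ℚᵘ.- e) ℚᵘ.* k* ℚᵘ.≤ k → v ℚᵘ.≤ o ℚᵘ.+ e ℚᵘ.* o
approximate-total {v} {k} {o} {k*} {P} {e} v+k≃P o+k*≃P e≥0 k*≤o k≥ = begin
  v
    ≃⟨ solve 2 (λ v k → v := v :+ k :- k) ℚᵘ.≃-refl v k ⟩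
  v ℚᵘ.+ k ℚᵘ.- k
    ≃⟨ ℚᵘ.+-congˡ (ℚᵘ.- k) (ℚᵘ.≃-trans v+k≃P (ℚᵘ.≃-sym o+k*≃P)) ⟩
  o ℚᵘ.+ k* ℚᵘ.- k
    ≤⟨ ℚᵘ.+-monoʳ-≤ (o ℚᵘ.+ k*) (ℚᵘ.neg-mono-≤ k≥) ⟩
  o ℚᵘ.+ k* ℚᵘ.- (1ℚᵘ ℚᵘ.- e) ℚᵘ.* k*
    ≃⟨ solve 3 (λ o k e → o :+ k :- (con 1ℚᵘ :- e) :* k := o :+ e :* k) ℚᵘ.≃-refl o k* e ⟩
  o ℚᵘ.+ e ℚᵘ.* k*
    ≤⟨ ℚᵘ.+-monoʳ-≤ o (ℚᵘ.*-monoʳ-≤-nonNeg e {{ℚᵘ.nonNegative e≥0}} k*≤o) ⟩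
  o ℚᵘ.+ e ℚᵘ.* o ∎
  where
  open ℚᵘ.≤-Reasoning
  open +-*-Solver using (solve; _:=_; _:+_; _:*_; _:-_; con)

-- Since makespans and cut have a fixed sum, this turns an optimal schedule into a maximum cut.
cut-complement-mono : ∀ {v k o k* P} → v ℚᵘ.+ k ≃ P → o ℚᵘ.+ k* ≃ P → o ℚᵘ.≤ v → k ℚᵘ.≤ k*
cut-complement-mono {v} {k} {o} {k*} {P} v+k≃P o+k*≃P o≤v = begin
  k                 ≃⟨ solve 2 (λ v k → k := v :+ k :- v) ℚᵘ.≃-refl v k ⟩
  v ℚᵘ.+ k ℚᵘ.- v   ≃⟨ ℚᵘ.+-congˡ (ℚᵘ.- v) (ℚᵘ.≃-trans v+k≃P (ℚᵘ.≃-sym o+k*≃P)) ⟩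
  o ℚᵘ.+ k* ℚᵘ.- v  ≤⟨ ℚᵘ.+-monoʳ-≤ (o ℚᵘ.+ k*) (ℚᵘ.neg-mono-≤ o≤v) ⟩
  o ℚᵘ.+ k* ℚᵘ.- o  ≃⟨ solve 2 (λ o k → o :+ k :- o := k) ℚᵘ.≃-refl o k* ⟩
  k*                ∎
  where
  open ℚᵘ.≤-Reasoning
  open +-*-Solver using (solve; _:=_; _:+_; _:-_)

approximation : ∀ {γ} → NonNegativeℝ γ → ∀ I → AtMostThreeJobs I → ∀ A →
  (∀ A* → IsMaximal MaxCut {graph I} A* →
    (1ℚᵘ +ℝ (-ℝ γ)) · Graph.cutWeight (graph I) A* ≤ Graph.cutWeight (graph I) A) →
  ∀ A* → IsMinimal SM2 {I} A* →
    SM2Instance.totalMakespan I A ≤ 1ℚᵘ +ℝ γ · SM2Instance.totalMakespan I A*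
approximation {γ} γ≥0 I small A A-approx A* A*-min q u = ℚᵘ.≤-respʳ-≃
  (solve 2 (λ o q → o :+ (q :- con 1ℚᵘ) :* o := q :* o) ℚᵘ.≃-refl (totalMakespan A*) q)
  (approximate-total (total+cut I small A) (total+cut I small A*) (ℚᵘ.<⇒≤ (γ≥0 u))
    (cut≤total I small A*)
    -- An upper bound `e` of `γ` makes `1 - e` a lower bound of `1 - γ`. Unfolded, this asks for
    -- `Upper γ` at `- (1 - e - 1)`, which equals `e` up to `≃`.
    (A-approx A* A*-max (1ℚᵘ ℚᵘ.- e) (Upper-resp-≃ γ
      (solve 1 (λ e → e := :- (con 1ℚᵘ :- e :- con 1ℚᵘ)) ℚᵘ.≃-refl e) u)))
  where
  open SM2Instance I using (totalMakespan)
  open +-*-Solver using (solve; _:=_; _:+_; _:*_; _:-_; :-_; con)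
  -- `q` is an upper bound of `1 + γ` precisely if `q - 1` is one of `γ`; it is then positive
  -- because `γ` is non-negative.
  e : ℚᵘ
  e = q ℚᵘ.- 1ℚᵘ
  A*-max : IsMaximal MaxCut {graph I} A*
  A*-max B = cut-complement-mono (total+cut I small B) (total+cut I small A*) (A*-min B)

-- Running time of the composed algorithm

preprocess : ∀ {A B C} {r : ⟦ A ⟧ → ⟦ B ⟧} (R : Computable A B r) (f : Prog B C) c d →
  ∃[ c′ ] ∃[ d′ ] ∀ {x y z t} → r x ≡ y → f ⊢ y ⇓ z ∣ t → t ≤ c * size B y ^ d + c →
    ∃[ t′ ] (program R ⨾ f ⊢ x ⇓ z ∣ t′) × t′ ≤ c′ * size A x ^ d′ + c′
preprocess {A} {B} {C} {r} R f c d = c′ , d′ , go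
  where
  Q P : Poly
  Q = bound R
  P = const c ⊛ power d ⊕ const c
  -- `Q` pays for the first program and also bounds the size of its output, on which the second
  -- costs at most `P`.
  bounded : ∃[ c′ ] ∃[ d′ ] ∀ n → 0 < n → eval (Q ⊕ P ⊙ Q) n ≤ c′ * n ^ d′
  bounded = eval-bound (Q ⊕ P ⊙ Q)
  c′ d′ : ℕ
  c′ = proj₁ bounded
  d′ = proj₁ (proj₂ bounded)
  go : ∀ {x y z t} → r x ≡ y → f ⊢ y ⇓ z ∣ t → t ≤ c * size B y ^ d + c →
    ∃[ t′ ] (program R ⨾ f ⊢ x ⇓ z ∣ t′) × t′ ≤ c′ * size A x ^ d′ + c′
  go {x} {t = t} refl run t≤ = R.cost + t , run-⨾ R.run run , (begin
    R.cost + t                            ≤⟨ +-mono-≤ R.cost≤ t≤ ⟩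
    eval Q N + (c * size B (r x) ^ d + c)
      ≡⟨ cong (λ m → eval Q N + (c * m + c)) (sym (eval-power d (size B (r x)))) ⟩
    eval Q N + eval P (size B (r x))      ≤⟨ +-monoʳ-≤ (eval Q N) (eval-mono P R.size≤) ⟩
    eval Q N + eval P (eval Q N)          ≡⟨ cong (eval Q N +_) (sym (eval-⊙ P Q N)) ⟩
    eval (Q ⊕ P ⊙ Q) N                    ≤⟨ proj₂ (proj₂ bounded) N (size>0 A x) ⟩
    c′ * N ^ d′                           ≤⟨ m≤m+n _ c′ ⟩
    c′ * N ^ d′ + c′                      ∎)
    where
    open ≤-Reasoning
    module R = Halts (halts R x)
    N : ℕ
    N = size A x

theorem8 : (γ : ℝ) → NonNegativeℝ γ →
    PolyTimeMaxApprox MaxCut (1ℚᵘ +ℝ (-ℝ γ)) →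
    PolyTimeMinApprox (restrict SM2 AtMostThreeJobs) (1ℚᵘ +ℝ γ)
theorem8 γ γ≥0 (maxCut , c , d , maxCut-run) =
  -- Jobs and vertices are the same indices, so the cut returned is itself the schedule and needs no
  -- translation back.
  let c′ , d′ , run-reduction = preprocess reductionᶜ maxCut c d
  in program reductionᶜ ⨾ maxCut , c′ , d′ , λ (I , small) → let
    A , _ , run , t≤ , A-approx = maxCut-run (graph I)
    t , run′ , t′≤ = run-reduction (reduction-encode I) run t≤
    in A , t , run′ , t′≤ , approximation {γ} γ≥0 I small A A-approx
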